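{- Let $m \geq 0$, $n \geq 1$ be integers. For every $w = w_1 \cdots w_{m+n-1} \in \mathrm{Motz}_{m,n-1}$, the configuration $c(w)$ is a sorted deterministically recurrent configuration on $K_{m,n}^0$, and $\Xi(\Phi(c(w))) = w$. Consequently, $w \mapsto c(w)$ is the bijection $\Phi^{ -1} \circ \Xi^{ -1}$ from $\mathrm{Motz}_{m,n-1}$ to the set of sorted deterministically recurrent configurations on $K_{m,n}^0$.
   Context: $K_{m,n}^0$ is the complete bipartite graph with "top" vertices $v^t_0, \ldots, v^t_m$ and "bottom" vertices $v^b_1, \ldots, v^b_n$, with an edge between every top and every bottom vertex; $v^t_0$ is the sink. A configuration is a vector $c = (c^t_1, \ldots, c^t_m; c^b_1, \ldots, c^b_n)$ of non-negative integers; it is sorted if $c^t$, $c^b$ are weakly increasing, stable if $c^t_i < n$ and $c^b_j < m+1$ for all $i,j$. Abelian sandpile model (ASM): an unstable non-sink vertex topples by sending one grain to each neighbour (bottom vertices also to the sink); grains sent to the sink disappear. In the Markov chain on stable configurations which adds a grain to a uniformly random non-sink vertex and stabilises by the ASM, a stable configuration is deterministically recurrent if it is a recurrent state. Labelled Motzkin paths: words in steps $U=(1,1)$, $D=(1,-1)$ and horizontal steps $H^N, H^E$ (both $=(1,0)$), starting and ending at height $0$ and never going below the $x$-axis. $\mathrm{Motz}_{m,n-1}$ is the set of such paths with $m+n-1$ steps, exactly $m$ of which are $U$ or $H^E$ (equivalently exactly $n-1$ are $D$ or $H^N$). For $w \in \mathrm{Motz}_{m,n-1}$, $c(w) = (c^t;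 c^b)$ is defined by: for $i \in \{1,\ldots,m\}$, if $w_j$ is the $i$-th step of $w$ belonging to $\{D, H^E\}$, then $c^t_i := |\{ j' < j : w_{j'} \in \{U, H^N\}\}|$; for $j \in \{1,\ldots,n-1\}$, if $w_i$ is the $j$-th step of $w$ belonging to $\{D, H^N\}$, then $c^b_j := |\{ i' < i : w_{i'} \in \{U, H^E\}\}|$; and $c^b_n := m$. A parallelogram polyomino in the box $[0,m+1]\times[0,n]$ is the set of unit cells between two lattice paths $\mathcal{U}$ (upper) and $\mathcal{L}$ (lower) from $(0,0)$ to $(m+1,n)$ with steps $N=(0,1)$, $E=(1,0)$, meeting only at their endpoints; necessarily $\mathcal{U} = (N, u_1, \ldots, u_{m+n-1}, E)$ and $\mathcal{L} = (E, \ell_1, \ldots, \ell_{m+n-1}, N)$. The map $\Xi$ sends such a polyomino to $w_1 \cdots w_{m+n-1}$ with $w_i = U$ if $(u_i,\ell_i) = (N,E)$, $w_i = H^N$ if $(u_i,\ell_i)=(N,N)$, $w_i = H^E$ if $(u_i,\ell_i) = (E,E)$, $w_i = D$ if $(u_i,\ell_i) = (E,N)$; it is known to be a bijection onto $\mathrm{Motz}_{m,n-1}$. The Dukes–Le Borgne map $\Phi$: for a sorted stable $c$, $\mathcal{U}(c^t)$ is the path from $(0,0)$ to $(m+1,n)$ whose $E$ steps occur at heights $1+c^t_1, \ldots, 1+c^t_m, n$, and $\mathcal{L}(c^b)$ the path from $(0,0)$ to $(m+1,n)$ whose $N$ steps occur at $x$-coordinates $1+c^b_1, \ldots, 1+c^b_n$;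 $\Phi(c)$ is the polyomino between them. It is known that $\Phi$ is a bijection from sorted deterministically recurrent configurations on $K_{m,n}^0$ to parallelogram polyominoes in $[0,m+1]\times[0,n]$. -}

module Defs where

open import Data.Bool.Base using (if_then_else_)
open import Data.Fin.Base using (Fin)
import Data.Fin.Base as Fin
import Data.Fin.Properties as Fin
import Data.Integer.Base as ℤ
open import Data.List.Base as List
  using (List; []; _∷_; _++_; [_]; length; take; drop; replicate; zipWith; allFin)
import Data.List.Properties as List
open import Data.Nat.Base
open import Data.Nat.Induction using (<-wellFounded)
open import Data.Nat.Properties
open import Data.Nat.Tactic.RingSolver using (solve-∀)
open import Data.Product.Base using (Σ; _×_; _,_; proj₁; proj₂; ∃-syntax)
open import Data.Product.Properties using () renaming (≡-dec to ×-≡-dec)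
open import Data.Rational.Base as ℚ using (ℚ; 0ℚ; 1ℚ)
open import Data.Sum.Base using (_⊎_)
open import Data.Vec.Base as Vec using (Vec; lookup; updateAt)
open import Data.Vec.Properties using () renaming (≡-dec to Vec-≡-dec)
open import Data.Vec.Relation.Unary.Linked using (Linked)
open import Induction.WellFounded using (Acc; acc)
open import Level using (0ℓ)
open import Relation.Binary.Bundles using (Setoid)
open import Relation.Binary.Construct.On as On using ()
open import Relation.Binary.Definitions using (DecidableEquality)
open import Relation.Binary.PropositionalEquality
  using (_≡_; refl; sym; trans; cong; subst; setoid; module ≡-Reasoning)
open import Relation.Nullary.Decidable using (Dec; yes; no; does)

-- The subset of A cut out by P: elements are compared by their value in A only.
subset : {A : Set} → (A → Set) → Setoid 0ℓ 0ℓ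
subset {A} P = On.setoid {B = Σ A P} (setoid A) proj₁

------------------------------------------------------------------------
-- The sandpile model on K⁰ₘ,ₙ

-- Non-sink vertices, numbered from 0; the sink vᵗ₀ is left implicit.
data Vertex (m n : ℕ) : Set where
  top    : Fin m → Vertex m n
  bottom : Fin n → Vertex m n

vertices : ∀ m n → List (Vertex m n)
vertices m n = List.map top (allFin m) ++ List.map bottom (allFin n)

Config : ℕ → ℕ → Set
Config m n = Vec ℕ m × Vec ℕ n

_≟ᶜ_ : ∀ {m n} → DecidableEquality (Config m n)
_≟ᶜ_ = ×-≡-dec (Vec-≡-dec _≟_) (Vec-≡-dec _≟_)

Sorted : ∀ {m n} → Config m n → Set
Sorted (t , b) = Linked _≤_ t × Linked _≤_ b

-- A bottom vertex is adjacent to the m non-sink top vertices and to the sink.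
degree : ∀ {m n} → Vertex m n → ℕ
degree {m} {n} (top _)    = n
degree {m} {n} (bottom _) = suc m

grains : ∀ {m n} → Config m n → Vertex m n → ℕ
grains (t , b) (top i)    = lookup t i
grains (t , b) (bottom j) = lookup b j

Unstable : ∀ {m n} → Config m n → Vertex m n → Set
Unstable c v = degree v ≤ grains c v

Stable : ∀ {m n} → Config m n → Set
Stable c = ∀ v → grains c v < degree v

addGrain : ∀ {m n} → Vertex m n → Config m n → Config m n
addGrain (top i)    (t , b) = updateAt t i suc , b
addGrain (bottom j) (t , b) = t , updateAt b j suc

topple : ∀ {m n} → Vertex m n → Config m n → Config m n
topple v@(top i)    (t , b) = updateAt t i (_∸ degree v) , Vec.map suc b
topple v@(bottom j) (t , b) = Vec.map suc t , updateAt b j (_∸ degree v)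

infix 4 _⟶*_

data _⟶*_ {m n} : Config m n → Config m n → Set where
  done : ∀ {c} → c ⟶* c
  then : ∀ {c d} v → Unstable c v → topple v c ⟶* d → c ⟶* d

private
  -- Every legal toppling strictly decreases this quantity.
  μ : ∀ {m n} → Config m n → ℕ
  μ {m} (t , b) = (2 + m) * Vec.sum t + (1 + m) * Vec.sum b

  sum-map-suc : ∀ {k} (xs : Vec ℕ k) → Vec.sum (Vec.map suc xs) ≡ k + Vec.sum xs
  sum-map-suc Vec.[] = refl
  sum-map-suc {suc k} (x Vec.∷ xs) rewrite sum-map-suc xs = lemma x k (Vec.sum xs)
    where
    lemma : ∀ a k s → suc (a + (k + s)) ≡ suc (k + (a + s))
    lemma = solve-∀

  sum-updateAt-∸ : ∀ {k} d (xs : Vec ℕ k) i → d ≤ lookup xs i →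
                   Vec.sum xs ≡ d + Vec.sum (updateAt xs i (_∸ d))
  sum-updateAt-∸ d (x Vec.∷ xs) Fin.zero d≤x =
    trans (cong (_+ Vec.sum xs) (sym (m+[n∸m]≡n d≤x))) (+-assoc d (x ∸ d) (Vec.sum xs))
  sum-updateAt-∸ d (x Vec.∷ xs) (Fin.suc i) d≤ rewrite sum-updateAt-∸ d xs i d≤ =
    lemma x d (Vec.sum (updateAt xs i (_∸ d)))
    where
    lemma : ∀ a d s → a + (d + s) ≡ d + (a + s)
    lemma = solve-∀

  μ-topple : ∀ {m n} .{{_ : NonZero n}} (c : Config m n) v →
             Unstable c v → μ (topple v c) < μ c
  μ-topple {m} {n} (t , b) (top i) u
    rewrite sum-map-suc b | sum-updateAt-∸ n t i u =
      subst (lhs <_) (sym (lemma m n (Vec.sum (updateAt t i (_∸ n))) (Vec.sum b)))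
            (m<n+m lhs (>-nonZero⁻¹ n))
    where
    lhs = (2 + m) * Vec.sum (updateAt t i (_∸ n)) + (1 + m) * (n + Vec.sum b)
    lemma : ∀ m n s r → (2 + m) * (n + s) + (1 + m) * r
                      ≡ n + ((2 + m) * s + (1 + m) * (n + r))
    lemma = solve-∀
  μ-topple {m} (t , b) (bottom j) u
    rewrite sum-map-suc t | sum-updateAt-∸ (suc m) b j u =
      ≤-reflexive (lemma m (Vec.sum t) (Vec.sum (updateAt b j (_∸ suc m))))
    where
    lemma : ∀ m s r → suc ((2 + m) * (m + s) + (1 + m) * r)
                    ≡ (2 + m) * s + (1 + m) * (suc m + r)
    lemma = solve-∀

  unstable? : ∀ {m n} (c : Config m n) → Dec (∃[ v ] Unstable c v)
  unstable? c with Fin.any? (λ i → degree (top i) ≤? grains c (top i))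
                 | Fin.any? (λ j → degree (bottom j) ≤? grains c (bottom j))
  ... | yes (i , u) | _           = yes (top i , u)
  ... | no _        | yes (j , u) = yes (bottom j , u)
  ... | no ¬t       | no ¬b       = no λ where
    (top i    , u) → ¬t (i , u)
    (bottom j , u) → ¬b (j , u)

  go : ∀ {m n} .{{_ : NonZero n}} (c : Config m n) → Acc _<_ (μ c) →
       ∃[ d ] c ⟶* d × Stable d
  go c (acc rs) with unstable? c
  ... | no ¬u       = c , done , λ v → ≰⇒> λ u → ¬u (v , u)
  ... | yes (v , u) with go (topple v c) (rs (μ-topple c v u))
  ...   | d , ts , st = d , then v u ts , st

stabilisation : ∀ {m n} .{{_ : NonZero n}} (c : Config m n) →
                ∃[ d ] c ⟶* d × Stable d
stabilisation c = go c (<-wellFounded (μ c))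

-- The model is abelian, so the order of topplings chosen above does not
-- influence the result.
stabilise : ∀ {m n} .{{_ : NonZero n}} → Config m n → Config m n
stabilise c = proj₁ (stabilisation c)

------------------------------------------------------------------------
-- The Markov chain and its recurrent states

instance
  m+n-nonZero : ∀ {m n} .{{_ : NonZero n}} → NonZero (m + n)
  m+n-nonZero {m} {n} = >-nonZero (≤-trans (>-nonZero⁻¹ n) (m≤n+m n m))

-- Expectation of f at a uniformly random non-sink vertex.
𝔼 : ∀ {m n} .{{_ : NonZero n}} → (Vertex m n → ℚ) → ℚ
𝔼 {m} {n} f =
  (ℤ.1ℤ ℚ./ (m + n)) ℚ.* List.foldr ℚ._+_ 0ℚ (List.map f (vertices m n))

step : ∀ {m n} .{{_ : NonZero n}} → Config m n → Vertex m n → Config m n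
step d v = stabilise (addGrain v d)

-- hitProb c k d is the probability that the chain started at d is in state c
-- at one of the times 1, …, k (first-step analysis).
hitProb : ∀ {m n} .{{_ : NonZero n}} → Config m n → ℕ → Config m n → ℚ
hitProb c zero    d = 0ℚ
hitProb c (suc k) d =
  𝔼 λ v → if does (step d v ≟ᶜ c) then 1ℚ else hitProb c k (step d v)

-- The chain started at c returns to c with probability 1.  As hitProb c k c is
-- nondecreasing in k, this is the statement that it tends to 1.
RecurrentState : ∀ {m n} .{{_ : NonZero n}} → Config m n → Set
RecurrentState c = ∀ ε → 0ℚ ℚ.< ε → ∃[ k ] 1ℚ ℚ.- ε ℚ.< hitProb c k c

DeterministicallyRecurrent : ∀ {m n} .{{_ : NonZero n}} → Config m n → Set
DeterministicallyRecurrent c = Stable c × RecurrentState c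

SortedRec : ∀ m n .{{_ : NonZero n}} → Setoid 0ℓ 0ℓ
SortedRec m n = subset {Config m n} λ c → Sorted c × DeterministicallyRecurrent c

------------------------------------------------------------------------
-- Labelled Motzkin paths

data MStep : Set where
  U D Hᴺ Hᴱ : MStep

-- Walk h w h′: the word w leads from height h to height h′; heights being
-- natural numbers, it stays weakly above the x-axis.
data Walk : ℕ → List MStep → ℕ → Set where
  []    : ∀ {h} → Walk h [] h
  up    : ∀ {h w h′} → Walk (suc h) w h′ → Walk h (U ∷ w) h′
  down  : ∀ {h w h′} → Walk h w h′ → Walk (suc h) (D ∷ w) h′
  horᴺ  : ∀ {h w h′} → Walk h w h′ → Walk h (Hᴺ ∷ w) h′
  horᴱ  : ∀ {h w h′} → Walk h w h′ → Walk h (Hᴱ ∷ w) h′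

#U,Hᴱ : List MStep → ℕ
#U,Hᴱ []       = 0
#U,Hᴱ (U  ∷ w) = suc (#U,Hᴱ w)
#U,Hᴱ (Hᴱ ∷ w) = suc (#U,Hᴱ w)
#U,Hᴱ (D  ∷ w) = #U,Hᴱ w
#U,Hᴱ (Hᴺ ∷ w) = #U,Hᴱ w

record IsMotzkin (m k : ℕ) (w : List MStep) : Set where
  field
    walk  : Walk 0 w 0
    steps : length w ≡ m + k
    count : #U,Hᴱ w ≡ m

Motz : ℕ → ℕ → Setoid 0ℓ 0ℓ
Motz m k = subset (IsMotzkin m k)

------------------------------------------------------------------------
-- The configuration c(w)

-- The accumulator a is the number of steps in {U, Hᴺ} read so far; it is
-- recorded at each step in {D, Hᴱ}.
topEntries : ℕ → List MStep → List ℕ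
topEntries a []       = []
topEntries a (U  ∷ w) = topEntries (suc a) w
topEntries a (Hᴺ ∷ w) = topEntries (suc a) w
topEntries a (D  ∷ w) = a ∷ topEntries a w
topEntries a (Hᴱ ∷ w) = a ∷ topEntries a w

-- Likewise, with counted steps {U, Hᴱ} and recording steps {D, Hᴺ}.
bottomEntries : ℕ → List MStep → List ℕ
bottomEntries a []       = []
bottomEntries a (U  ∷ w) = bottomEntries (suc a) w
bottomEntries a (Hᴱ ∷ w) = bottomEntries (suc a) w
bottomEntries a (D  ∷ w) = a ∷ bottomEntries a w
bottomEntries a (Hᴺ ∷ w) = a ∷ bottomEntries a w

private
  topEntries-count : ∀ {h w h′} a → Walk h w h′ →
                     h′ + length (topEntries a w) ≡ h + #U,Hᴱ w
  topEntries-count a []               = refl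
  topEntries-count {h} {U ∷ w} a (up p) =
    trans (topEntries-count (suc a) p) (sym (+-suc h (#U,Hᴱ w)))
  topEntries-count {h′ = h′} a (down p) =
    trans (+-suc h′ _) (cong suc (topEntries-count a p))
  topEntries-count a (horᴺ p)         = topEntries-count (suc a) p
  topEntries-count {h} {h′ = h′} a (horᴱ p) =
    trans (+-suc h′ _) (trans (cong suc (topEntries-count a p)) (sym (+-suc h _)))

  bottomEntries-count : ∀ a w → #U,Hᴱ w + length (bottomEntries a w) ≡ length w
  bottomEntries-count a []       = refl
  bottomEntries-count a (U  ∷ w) = cong suc (bottomEntries-count (suc a) w)
  bottomEntries-count a (Hᴱ ∷ w) = cong suc (bottomEntries-count (suc a) w)
  bottomEntries-count a (D  ∷ w) =
    trans (+-suc (#U,Hᴱ w) _) (cong suc (bottomEntries-count a w))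
  bottomEntries-count a (Hᴺ ∷ w) =
    trans (+-suc (#U,Hᴱ w) _) (cong suc (bottomEntries-count a w))

length-top : ∀ {m k w} → IsMotzkin m k w → length (topEntries 0 w) ≡ m
length-top p = trans (topEntries-count 0 walk) count
  where open IsMotzkin p

length-bottom : ∀ {m n} .{{_ : NonZero n}} {w} → IsMotzkin m (pred n) w →
                length (bottomEntries 0 w ++ [ m ]) ≡ n
length-bottom {m} {n} {w = w} p = begin
  length (bottomEntries 0 w ++ [ m ])  ≡⟨ List.length-++ (bottomEntries 0 w) ⟩
  length (bottomEntries 0 w) + 1       ≡⟨ +-comm _ 1 ⟩
  suc (length (bottomEntries 0 w))     ≡⟨ cong suc (+-cancelˡ-≡ m _ _ eq) ⟩
  suc (pred n)                         ≡⟨ suc-pred n ⟩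
  n                                    ∎
  where
  open ≡-Reasoning
  open IsMotzkin p
  eq : m + length (bottomEntries 0 w) ≡ m + pred n
  eq = trans (cong (_+ length (bottomEntries 0 w)) (sym count))
             (trans (bottomEntries-count 0 w) steps)

config : ∀ {m n} .{{_ : NonZero n}} → Setoid.Carrier (Motz m (pred n)) → Config m n
config {m} (w , p) =
  Vec.cast (length-top p) (Vec.fromList (topEntries 0 w)) ,
  Vec.cast (length-bottom p) (Vec.fromList (bottomEntries 0 w ++ [ m ]))

------------------------------------------------------------------------
-- Parallelogram polyominoes

data Step : Set where
  N E : Step

LatticePath : Set
LatticePath = List Step

-- End point of a path that starts at (0 , 0).
end : LatticePath → ℕ × ℕ
end []      = 0 , 0
end (N ∷ p) = proj₁ (end p) , suc (proj₂ (end p))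
end (E ∷ p) = suc (proj₁ (end p)) , proj₂ (end p)

-- A polyomino is represented by its pair of boundary paths, which determines
-- its set of cells and is determined by it.
record IsParallelogram (m n : ℕ) (P : LatticePath × LatticePath) : Set where
  upper = proj₁ P
  lower = proj₂ P
  field
    end-upper : end upper ≡ (suc m , n)
    end-lower : end lower ≡ (suc m , n)
    above     : ∀ k → proj₂ (end (take k lower)) ≤ proj₂ (end (take k upper))
    meet      : ∀ i j → end (take i upper) ≡ end (take j lower) →
                end (take i upper) ≡ (0 , 0) ⊎ end (take i upper) ≡ (suc m , n)

Polyomino : ℕ → ℕ → Setoid 0ℓ 0ℓ
Polyomino m n = subset (IsParallelogram m n)

-- Strips the first and the last step.
inner : LatticePath → LatticePath
inner p = take (length p ∸ 2) (drop 1 p)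

label : Step → Step → MStep
label N E = U
label N N = Hᴺ
label E E = Hᴱ
label E N = D

Ξ : LatticePath × LatticePath → List MStep
Ξ (u , ℓ) = zipWith label (inner u) (inner ℓ)

-- pathVia a b l x xs: from a-coordinate x, the path of steps a and b reaching
-- a-coordinate l, whose b steps occur at the a-coordinates xs (which should be
-- weakly increasing and lie between x and l).
pathVia : (a b : Step) (l x : ℕ) → List ℕ → LatticePath
pathVia a b l x []       = replicate (l ∸ x) a
pathVia a b l x (y ∷ ys) = replicate (y ∸ x) a ++ b ∷ pathVia a b l y ys

upperPath : ∀ {m} (n : ℕ) → Vec ℕ m → LatticePath
upperPath n t = pathVia N E n 0 (List.map suc (Vec.toList t) ++ [ n ])

lowerPath : ∀ {n} (m : ℕ) → Vec ℕ n → LatticePath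
lowerPath m b = pathVia E N (suc m) 0 (List.map suc (Vec.toList b))

Φ : ∀ {m n} → Config m n → LatticePath × LatticePath
Φ {m} {n} (t , b) = upperPath n t , lowerPath m b

{-# OPTIONS --safe #-}
module Submission where

-- A configuration has a forbidden subconfiguration if some a top and b bottom vertices
-- (a, b > 0) carry fewer than b, respectively a, grains each.  Having none is preserved by
-- adding grains and by toppling, and it holds for the maximal stable configuration, which
-- is reached with positive probability from every state, so recurrent configurations have
-- none.  Conversely, if a sorted stable c has none, then after a toppling of the sink all
-- vertices can topple once, in decreasing order of their indices, which restores c.  Hence
-- some configuration above all stable ones topples to c, so c is hit within boundedly many
-- steps with probability at least δ > 0 from any stable state, and the probability of
-- missing it decays geometrically.
-- Two lattice paths yield a Motzkin path unless at some point they have the same number of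
-- N steps and continue with E above and N below.  Such a crossing makes the framed paths
-- meet, and it is a forbidden subconfiguration of the configuration read off the paths.

open import Defs
open import Data.Bool.Base using (true; false; if_then_else_)
open import Data.Empty using (⊥; ⊥-elim)
open import Data.Fin.Base as Fin using (Fin; toℕ; fromℕ<)
import Data.Fin.Properties as Fin
import Data.Integer.Base as ℤ
import Data.Integer.Properties as ℤ
open import Data.List.Base as List
  using (List; []; _∷_; _++_; [_]; _∷ʳ_; length; take; replicate; zipWith; foldl; allFin; initLast; _∷ʳ′_)
import Data.List.Properties as List
open import Data.List.Membership.Propositional using (_∈_)
open import Data.List.Membership.Propositional.Properties using (∈-map⁺; ∈-++⁺ˡ; ∈-++⁺ʳ; ∈-allFin)
open import Data.List.Relation.Unary.Any using (here; there)
open import Data.Nat.Base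
open import Data.Nat.Properties
open import Data.Product.Base using (Σ-syntax; ∃-syntax; _×_; _,_; proj₁; proj₂)
open import Data.Rational.Base as ℚ using (ℚ; 0ℚ; 1ℚ)
import Data.Rational.Properties as ℚ
open import Data.Rational.Solver using (module +-*-Solver)
import Data.Rational.Unnormalised.Base as ℚᵘ
import Data.Rational.Unnormalised.Properties as ℚᵘ
open import Data.Sum.Base using (_⊎_; inj₁; inj₂)
open import Data.Vec.Base as Vec using (Vec; lookup; updateAt; toList)
open import Data.Vec.Properties as Vec
  using (lookup-map; map-updateAt; updateAt-updateAt; updateAt-updateAt-local; updateAt-commutes;
         updateAt-id-local; lookup∘updateAt; lookup∘updateAt′; tabulate∘lookup; tabulate-cong)
open import Data.Vec.Relation.Unary.Linked using (Linked; []; [-]; _∷_; tail)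
open import Data.Vec.Relation.Unary.Linked.Properties using () renaming (lookup⁺ to Linked-lookup)
open import Function.Base using (_∘_; flip)
open import Function.Bundles using (Inverse)
open import Relation.Binary.Bundles using (Setoid)
open import Relation.Binary.Definitions using (DecidableEquality)
open import Relation.Binary.PropositionalEquality
  using (_≡_; _≢_; refl; sym; trans; cong; cong₂; subst; subst₂; module ≡-Reasoning)
open import Relation.Nullary using (¬_; yes; no; does; contradiction)
open Setoid using (Carrier)
open Inverse using (to; from)

-- That `Φ` and `Ξ` are bijections is proved along the way. The maps `config`, `Φ` and `Ξ` run
-- around a triangle of words, configurations and polyominoes; once the three round trips are the
-- identity, each map has the composite of the other two as its inverse. This is why recurrence is
-- characterised in both directions: that `c(w)` is recurrent uses one of them, while writing an
-- arbitrary sorted recurrent configuration as some `c(w)`, and so seeing that `Φ` sends it to a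
-- polyomino, uses the other. All top vertices have the same neighbours, and so have all bottom
-- vertices. Hence forbidden subconfigurations matter only through two sizes, and counting entries
-- below a threshold replaces naming sets of vertices; sortedness turns such counts into indices.

lookup-ext : ∀ {A : Set} {k} {xs ys : Vec A k} → (∀ i → lookup xs i ≡ lookup ys i) → xs ≡ ys
lookup-ext {xs = xs} {ys} eq =
  trans (sym (tabulate∘lookup xs)) (trans (tabulate-cong eq) (tabulate∘lookup ys))

grains-ext : ∀ {m n} {c d : Config m n} → (∀ v → grains c v ≡ grains d v) → c ≡ d
grains-ext eq = cong₂ _,_ (lookup-ext (eq ∘ top)) (lookup-ext (eq ∘ bottom))

top-injective : ∀ {m n i j} → top {m} {n} i ≡ top j → i ≡ j
top-injective refl = refl

bottom-injective : ∀ {m n i j} → bottom {m} {n} i ≡ bottom j → i ≡ j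
bottom-injective refl = refl

_≟ᵛ_ : ∀ {m n} → DecidableEquality (Vertex m n)
top i    ≟ᵛ top j    with i Fin.≟ j
... | yes refl = yes refl
... | no i≢j   = no (i≢j ∘ top-injective)
top _    ≟ᵛ bottom _ = no λ ()
bottom _ ≟ᵛ top _    = no λ ()
bottom i ≟ᵛ bottom j with i Fin.≟ j
... | yes refl = yes refl
... | no i≢j   = no (i≢j ∘ bottom-injective)

-- Stabilisation

infixr 5 _⟶*-++_

_⟶*-++_ : ∀ {m n} {c d e : Config m n} → c ⟶* d → d ⟶* e → c ⟶* e
done       ⟶*-++ s = s
then v u r ⟶*-++ s = then v u (r ⟶*-++ s)

-- The hypothesis is due to truncated subtraction: for `x < d`, `suc (x ∸ d)` and `suc x ∸ d`
-- differ.
map-suc-∸ : ∀ {k d} (xs : Vec ℕ k) i → d ≤ lookup xs i →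
            Vec.map suc (updateAt xs i (_∸ d)) ≡ updateAt (Vec.map suc xs) i (_∸ d)
map-suc-∸ xs i d≤ = map-updateAt xs i (sym (+-∸-assoc 1 d≤))

topple-comm : ∀ {m n} (c : Config m n) u v → u ≢ v → Unstable c u → Unstable c v →
              topple u (topple v c) ≡ topple v (topple u c)
topple-comm (t , b) (top i) (top j) u≢v _ _ =
  cong (_, _) (updateAt-commutes i j (u≢v ∘ cong top) t)
topple-comm (t , b) (bottom i) (bottom j) u≢v _ _ =
  cong (_ ,_) (updateAt-commutes i j (u≢v ∘ cong bottom) b)
topple-comm (t , b) (top i) (bottom j) _ p q =
  cong₂ _,_ (sym (map-suc-∸ t i p)) (map-suc-∸ b j q)
topple-comm (t , b) (bottom i) (top j) _ p q =
  cong₂ _,_ (map-suc-∸ t j q) (sym (map-suc-∸ b i p))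

unstable-topple : ∀ {m n} (c : Config m n) u v → u ≢ v → Unstable c u → Unstable (topple v c) u
unstable-topple (t , b) (top i) (top j) u≢v p =
  subst (_ ≤_) (sym (lookup∘updateAt′ i j (u≢v ∘ cong top) t)) p
unstable-topple (t , b) (bottom i) (bottom j) u≢v p =
  subst (_ ≤_) (sym (lookup∘updateAt′ i j (u≢v ∘ cong bottom) b)) p
unstable-topple (t , b) (top i) (bottom j) _ p =
  subst (_ ≤_) (sym (lookup-map i suc t)) (m≤n⇒m≤1+n p)
unstable-topple (t , b) (bottom i) (top j) _ p =
  subst (_ ≤_) (sym (lookup-map i suc b)) (m≤n⇒m≤1+n p)

-- Exchange argument: `v` loses grains only by toppling, so a sequence with a stable end must topple
-- it somewhere. Its first toppling commutes with all earlier ones and is moved to the front.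
topple-⟶*-stable : ∀ {m n} {c d : Config m n} v → c ⟶* d → Stable d → Unstable c v →
                   topple v c ⟶* d
topple-⟶*-stable v done st p = contradiction p (<⇒≱ (st v))
topple-⟶*-stable {c = c} v (then u q r) st p with u ≟ᵛ v
... | yes refl = r
... | no u≢v   =
  then u (unstable-topple c u v u≢v q)
    (subst (_⟶* _) (topple-comm c v u (u≢v ∘ sym) p q)
      (topple-⟶*-stable v r st (unstable-topple c v u (u≢v ∘ sym) p)))

-- The topplings of the first sequence are removed from the second one by one, by exchange. This
-- makes the order chosen by `stabilise` harmless.
⟶*-confluent : ∀ {m n} {c d e : Config m n} → c ⟶* e → c ⟶* d → Stable d → e ⟶* d
⟶*-confluent done         s st = s
⟶*-confluent (then v p r) s st = ⟶*-confluent r (topple-⟶*-stable v s st p) st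

stable-⟶* : ∀ {m n} {c d : Config m n} → Stable c → c ⟶* d → c ≡ d
stable-⟶* st done         = refl
stable-⟶* st (then v u _) = contradiction u (<⇒≱ (st v))

stabilise-⟶* : ∀ {m n} .{{_ : NonZero n}} (c : Config m n) → c ⟶* stabilise c
stabilise-⟶* c = proj₁ (proj₂ (stabilisation c))

stabilise-stable : ∀ {m n} .{{_ : NonZero n}} (c : Config m n) → Stable (stabilise c)
stabilise-stable c = proj₂ (proj₂ (stabilisation c))

-- Adding grains

-- Isolates what adding grains and firing the sink have in common, so that `lift-⟶*` serves both.
Compatible : ∀ {m n} → (Config m n → Config m n) → Set
Compatible f = ∀ c v → Unstable c v → Unstable (f c) v × topple v (f c) ≡ f (topple v c)

lift-⟶* : ∀ {m n} {f : Config m n → Config m n} → Compatible f →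
          ∀ {c d} → c ⟶* d → f c ⟶* f d
lift-⟶* cf done = done
lift-⟶* {f = f} cf {c} (then v u r) with cf c v u
... | u′ , eq = then v u′ (subst (_⟶* _) (sym eq) (lift-⟶* cf r))

addTo : ∀ {m n} → ℕ → Vertex m n → Config m n → Config m n
addTo k (top i)    (t , b) = updateAt t i (k +_) , b
addTo k (bottom j) (t , b) = t , updateAt b j (k +_)

grains-addTo-≡ : ∀ {m n} k v (c : Config m n) → grains (addTo k v c) v ≡ k + grains c v
grains-addTo-≡ k (top i)    (t , b) = lookup∘updateAt i t
grains-addTo-≡ k (bottom j) (t , b) = lookup∘updateAt j b

grains-addTo-≢ : ∀ {m n} k v w (c : Config m n) → w ≢ v → grains (addTo k v c) w ≡ grains c w
grains-addTo-≢ k (top i)    (top j)    (t , b) w≢v = lookup∘updateAt′ j i (w≢v ∘ cong top) t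
grains-addTo-≢ k (top i)    (bottom j) c       w≢v = refl
grains-addTo-≢ k (bottom i) (top j)    c       w≢v = refl
grains-addTo-≢ k (bottom i) (bottom j) (t , b) w≢v = lookup∘updateAt′ j i (w≢v ∘ cong bottom) b

grains-addTo-≤ : ∀ {m n} k v (c : Config m n) w → grains c w ≤ grains (addTo k v c) w
grains-addTo-≤ k v c w with w ≟ᵛ v
... | yes refl = subst (grains c v ≤_) (sym (grains-addTo-≡ k v c)) (m≤n+m _ k)
... | no w≢v   = ≤-reflexive (sym (grains-addTo-≢ k v w c w≢v))

updateAt-+-∸ : ∀ {k} (xs : Vec ℕ k) a d i j → d ≤ lookup xs i →
               updateAt (updateAt xs j (a +_)) i (_∸ d) ≡ updateAt (updateAt xs i (_∸ d)) j (a +_)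
updateAt-+-∸ xs a d i j d≤ with i Fin.≟ j
... | no i≢j   = updateAt-commutes i j i≢j xs
... | yes refl = trans (updateAt-updateAt-local i xs (+-∸-assoc a d≤)) (sym (updateAt-updateAt i xs))

addTo-compatible : ∀ {m n} k (v : Vertex m n) → Compatible (addTo k v)
addTo-compatible k v c w p = ≤-trans p (grains-addTo-≤ k v c w) , eq v w c p
  where
  eq : ∀ v w c → Unstable c w → topple w (addTo k v c) ≡ addTo k v (topple w c)
  eq (top i)    (top j)    (t , b) p = cong (_, _) (updateAt-+-∸ t k _ j i p)
  eq (bottom i) (bottom j) (t , b) p = cong (_ ,_) (updateAt-+-∸ b k _ j i p)
  eq (top i)    (bottom j) (t , b) p = cong (_, _) (map-updateAt t i (sym (+-suc k _)))
  eq (bottom i) (top j)    (t , b) p = cong (_ ,_) (map-updateAt b i (sym (+-suc k _)))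

addGrain-compatible : ∀ {m n} (v : Vertex m n) → Compatible (addGrain v)
addGrain-compatible (top i)    = addTo-compatible 1 (top i)
addGrain-compatible (bottom j) = addTo-compatible 1 (bottom j)

addGrains : ∀ {m n} → List (Vertex m n) → Config m n → Config m n
addGrains vs c = foldl (flip addGrain) c vs

addGrains-⟶* : ∀ {m n} vs {c d : Config m n} → c ⟶* d → addGrains vs c ⟶* addGrains vs d
addGrains-⟶* []       r = r
addGrains-⟶* (v ∷ vs) r = addGrains-⟶* vs (lift-⟶* (addGrain-compatible v) r)

grains-addGrain-≤ : ∀ {m n} v (c : Config m n) w → grains c w ≤ grains (addGrain v c) w
grains-addGrain-≤ (top i)    = grains-addTo-≤ 1 (top i)
grains-addGrain-≤ (bottom j) = grains-addTo-≤ 1 (bottom j)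

grains-addGrain-≡ : ∀ {m n} v (c : Config m n) → grains (addGrain v c) v ≡ suc (grains c v)
grains-addGrain-≡ (top i)    = grains-addTo-≡ 1 (top i)
grains-addGrain-≡ (bottom j) = grains-addTo-≡ 1 (bottom j)

grains-addGrains-≤ : ∀ {m n} vs (c : Config m n) w → grains c w ≤ grains (addGrains vs c) w
grains-addGrains-≤ []       c w = ≤-refl
grains-addGrains-≤ (v ∷ vs) c w =
  ≤-trans (grains-addGrain-≤ v c w) (grains-addGrains-≤ vs (addGrain v c) w)

incr : ∀ {k} → Vec ℕ k → List (Fin k) → Vec ℕ k
incr = foldl (λ xs i → updateAt xs i suc)

incr-zeros : ∀ {k} r x (xs : Vec ℕ k) → incr (x Vec.∷ xs) (List.replicate r Fin.zero) ≡ (r + x) Vec.∷ xs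
incr-zeros zero    x xs = refl
incr-zeros (suc r) x xs = trans (incr-zeros r (suc x) xs) (cong (Vec._∷ xs) (+-suc r x))

incr-sucs : ∀ {k} x (xs : Vec ℕ k) ks → incr (x Vec.∷ xs) (List.map Fin.suc ks) ≡ x Vec.∷ incr xs ks
incr-sucs x xs []       = refl
incr-sucs x xs (i ∷ ks) = incr-sucs x (updateAt xs i suc) ks

≤⇒incr : ∀ {k} (xs ys : Vec ℕ k) → (∀ i → lookup xs i ≤ lookup ys i) → ∃[ ks ] incr xs ks ≡ ys
≤⇒incr Vec.[]       Vec.[]       le = [] , refl
≤⇒incr (x Vec.∷ xs) (y Vec.∷ ys) le with ≤⇒incr xs ys (le ∘ Fin.suc)
... | ks , eq = zeros ++ List.map Fin.suc ks , (begin
  incr (x Vec.∷ xs) (zeros ++ List.map Fin.suc ks)        ≡⟨ List.foldl-++ _ (x Vec.∷ xs) zeros _ ⟩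
  incr (incr (x Vec.∷ xs) zeros) (List.map Fin.suc ks)    ≡⟨ cong (λ zs → incr zs (List.map Fin.suc ks))
                                                                (incr-zeros (y ∸ x) x xs) ⟩
  incr ((y ∸ x + x) Vec.∷ xs) (List.map Fin.suc ks)       ≡⟨ incr-sucs (y ∸ x + x) xs ks ⟩
  (y ∸ x + x) Vec.∷ incr xs ks                            ≡⟨ cong₂ Vec._∷_ (m∸n+n≡m (le Fin.zero)) eq ⟩
  y Vec.∷ ys                                              ∎)
  where
  open ≡-Reasoning
  zeros = List.replicate (y ∸ x) Fin.zero

≤⇒addGrains : ∀ {m n} (c d : Config m n) → (∀ v → grains c v ≤ grains d v) → ∃[ vs ] addGrains vs c ≡ d
≤⇒addGrains {m} {n} (t , b) (t′ , b′) le with ≤⇒incr t t′ (le ∘ top) | ≤⇒incr b b′ (le ∘ bottom)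
... | ks , eqt | ls , eqb = List.map top ks ++ List.map bottom ls ,
  trans (List.foldl-++ _ (t , b) (List.map top ks) _)
        (trans (cong (addGrains (List.map bottom ls)) (tops t ks))
               (trans (bottoms b ls) (cong₂ _,_ eqt eqb)))
  where
  tops : ∀ t ks → addGrains {m} {n} (List.map top ks) (t , b) ≡ (incr t ks , b)
  tops t []       = refl
  tops t (i ∷ ks) = tops (updateAt t i suc) ks
  bottoms : ∀ {t} b ls → addGrains {m} {n} (List.map bottom ls) (t , b) ≡ (t , incr b ls)
  bottoms b []       = refl
  bottoms b (j ∷ ls) = bottoms (updateAt b j suc) ls

total : ∀ {m n} → Config m n → ℕ
total (t , b) = Vec.sum t + Vec.sum b

sum-updateAt-suc : ∀ {k} (xs : Vec ℕ k) i → Vec.sum (updateAt xs i suc) ≡ suc (Vec.sum xs)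
sum-updateAt-suc (x Vec.∷ xs) Fin.zero    = refl
sum-updateAt-suc (x Vec.∷ xs) (Fin.suc i) =
  trans (cong (x +_) (sum-updateAt-suc xs i)) (+-suc x _)

total-addGrain : ∀ {m n} v (c : Config m n) → total (addGrain v c) ≡ suc (total c)
total-addGrain (top i)    (t , b) = cong (_+ _) (sum-updateAt-suc t i)
total-addGrain (bottom j) (t , b) = trans (cong (Vec.sum t +_) (sum-updateAt-suc b j)) (+-suc _ _)

total-addGrains : ∀ {m n} vs (c : Config m n) → total (addGrains vs c) ≡ length vs + total c
total-addGrains []       c = refl
total-addGrains (v ∷ vs) c =
  trans (total-addGrains vs (addGrain v c))
        (trans (cong (length vs +_) (total-addGrain v c)) (+-suc _ _))

-- Firing the sink

fireSink : ∀ {m n} → Config m n → Config m n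
fireSink (t , b) = t , Vec.map suc b

fireSink-compatible : ∀ {m n} → Compatible (fireSink {m} {n})
fireSink-compatible (t , b) (top i)    p = p , refl
fireSink-compatible (t , b) (bottom j) p =
  subst (_ ≤_) (sym (lookup-map j suc b)) (m≤n⇒m≤1+n p) , cong (_ ,_) (sym (map-suc-∸ b j p))

module _ {m n} {c : Config m n} (burn : fireSink c ⟶* c) where

  fireSink-returns : ∀ {d} → d ⟶* c → fireSink d ⟶* c
  fireSink-returns r = lift-⟶* fireSink-compatible r ⟶*-++ burn

  -- Toppling `top i` takes the `n` extra grains away again and gives one to each bottom vertex,
  -- which is the effect of firing the sink; `burn` undoes that.
  addTop-returns : ∀ i {d} → d ⟶* c → addTo n (top i) d ⟶* c
  addTop-returns i r = lift-⟶* (addTo-compatible n (top i)) r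
    ⟶*-++ then (top i) (subst (n ≤_) (sym (grains-addTo-≡ n (top i) c)) (m≤m+n n _))
                (subst (_⟶* c) (sym (cong (_, _) eq)) burn)
    where
    t = proj₁ c
    eq : updateAt (updateAt t i (n +_)) i (_∸ n) ≡ t
    eq = trans (updateAt-updateAt i t) (updateAt-id-local i t (m+n∸m≡n n (lookup t i)))

  full-tops : ∀ i → i ≤ m → ∃[ d ] d ⟶* c × (∀ k → toℕ k < i → n ≤ grains d (top k))
  full-tops zero    _   = c , done , λ _ ()
  full-tops (suc i) i<m with full-tops i (<⇒≤ i<m)
  ... | d , r , full = addTo n (top i′) d , addTop-returns i′ r , full′
    where
    i′ = fromℕ< i<m
    full′ : ∀ k → toℕ k < suc i → n ≤ grains (addTo n (top i′) d) (top k)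
    full′ k k≤i with k Fin.≟ i′
    ... | yes refl = subst (n ≤_) (sym (grains-addTo-≡ n (top i′) d)) (m≤m+n n _)
    ... | no k≢i   = ≤-trans (full k (≤∧≢⇒< (≤-pred k≤i) λ eq →
                               k≢i (Fin.toℕ-injective (trans eq (sym (Fin.toℕ-fromℕ< i<m))))))
                             (grains-addTo-≤ n (top i′) d (top k))

  -- Once the tops are full, every firing of the sink raises all bottom vertices by one and leaves
  -- the tops untouched.
  full-bottoms : ∀ r → ∃[ d ] d ⟶* c × (∀ k → n ≤ grains d (top k)) × (∀ l → r ≤ grains d (bottom l))
  full-bottoms zero with full-tops m ≤-refl
  ... | d , p , full = d , p , (λ k → full k (Fin.toℕ<n k)) , λ _ → z≤n
  full-bottoms (suc r) with full-bottoms r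
  ... | (t , b) , p , ft , fb =
    fireSink (t , b) , fireSink-returns p , ft , λ l → subst (suc r ≤_) (sym (lookup-map l suc b)) (s≤s (fb l))

  full : ∃[ d ] d ⟶* c × (∀ v → Unstable d v)
  full with full-bottoms (suc m)
  ... | d , r , ft , fb = d , r , λ { (top i) → ft i ; (bottom j) → fb j }

-- Forbidden subconfigurations

-- The indicator of `x < z`, with values in ℕ so that `countBelow` is a plain sum.
below : ℕ → ℕ → ℕ
below zero    x       = 0
below (suc z) zero    = 1
below (suc z) (suc x) = below z x

countBelow : ℕ → List ℕ → ℕ
countBelow z []       = 0
countBelow z (x ∷ xs) = below z x + countBelow z xs

below≤1 : ∀ z x → below z x ≤ 1
below≤1 zero    x       = z≤n
below≤1 (suc z) zero    = ≤-refl
below≤1 (suc z) (suc x) = below≤1 z x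

below-suc : ∀ z x → below z (suc x) ≤ below z x
below-suc zero          x       = z≤n
below-suc (suc zero)    zero    = z≤n
below-suc (suc (suc z)) zero    = ≤-refl
below-suc (suc z)       (suc x) = below-suc z x

below-< : ∀ {z x} → x < z → below z x ≡ 1
below-< {suc z} {zero}  (s≤s _)   = refl
below-< {suc z} {suc x} (s≤s x<z) = below-< x<z

below-≥ : ∀ {z x} → z ≤ x → below z x ≡ 0
below-≥ z≤n       = refl
below-≥ (s≤s z≤x) = below-≥ z≤x

countBelow-zero : ∀ xs → countBelow 0 xs ≡ 0
countBelow-zero []       = refl
countBelow-zero (x ∷ xs) = countBelow-zero xs

countBelow≤length : ∀ z xs → countBelow z xs ≤ length xs
countBelow≤length z []       = z≤n
countBelow≤length z (x ∷ xs) = +-mono-≤ (below≤1 z x) (countBelow≤length z xs)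

countBelow-++ : ∀ z xs ys → countBelow z (xs ++ ys) ≡ countBelow z xs + countBelow z ys
countBelow-++ z []       ys = refl
countBelow-++ z (x ∷ xs) ys = trans (cong (below z x +_) (countBelow-++ z xs ys)) (sym (+-assoc (below z x) _ _))

countBelow-map-suc : ∀ {k} z (xs : Vec ℕ k) →
                     countBelow (suc z) (toList (Vec.map suc xs)) ≡ countBelow z (toList xs)
countBelow-map-suc z Vec.[]       = refl
countBelow-map-suc z (x Vec.∷ xs) = cong (below z x +_) (countBelow-map-suc z xs)

countBelow-updateAt-suc : ∀ {k} z (xs : Vec ℕ k) i →
                          countBelow z (toList (updateAt xs i suc)) ≤ countBelow z (toList xs)
countBelow-updateAt-suc z (x Vec.∷ xs) Fin.zero    = +-monoˡ-≤ _ (below-suc z x)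
countBelow-updateAt-suc z (x Vec.∷ xs) (Fin.suc i) = +-monoʳ-≤ (below z x) (countBelow-updateAt-suc z xs i)

countBelow-updateAt : ∀ {k} z (xs : Vec ℕ k) i f →
                      countBelow z (toList (updateAt xs i f)) ≤ suc (countBelow z (toList xs))
countBelow-updateAt z (x Vec.∷ xs) Fin.zero    f = +-mono-≤ (below≤1 z (f x)) (m≤n+m _ (below z x))
countBelow-updateAt z (x Vec.∷ xs) (Fin.suc i) f =
  ≤-trans (+-monoʳ-≤ (below z x) (countBelow-updateAt z xs i f)) (≤-reflexive (+-suc _ _))

-- The a + 1 top vertices with at most b grains and the b + 1 bottom vertices with at most
-- a grains each carry fewer grains than they have neighbours among these vertices.
Forbidden : List ℕ → List ℕ → Set
Forbidden ts bs = ∃[ a ] ∃[ b ] suc a ≤ countBelow (suc b) ts × suc b ≤ countBelow (suc a) bs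

countBelow-replicate : ∀ {z x} r → z ≤ x → countBelow z (toList (Vec.replicate r x)) ≡ 0
countBelow-replicate zero    z≤x = refl
countBelow-replicate (suc r) z≤x = cong₂ _+_ (below-≥ z≤x) (countBelow-replicate r z≤x)

Allowed : ∀ {m n} → Config m n → Set
Allowed (t , b) = ¬ Forbidden (toList t) (toList b)

-- A toppling adds at most the toppled vertex to the small entries of its own side, while every
-- vertex of the other side gains a grain. So a forbidden pair after the toppling gives one before
-- it, with one size lowered by one.
allowed-topple : ∀ {m n} (c : Config m n) v → Allowed c → Allowed (topple v c)
allowed-topple (t , b) (top i) ok (p , q , le , le′) =
  go p (≤-trans le (countBelow-updateAt (suc q) t i _)) (subst (suc q ≤_) (countBelow-map-suc p b) le′)
  where
  go : ∀ p → suc p ≤ suc (countBelow (suc q) (toList t)) → suc q ≤ countBelow p (toList b) → ⊥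
  -- Size 0 is impossible: it would need bottom vertices that held fewer than 0 grains before the
  -- toppling.
  go zero    _  le = contradiction le (<⇒≱ (subst (_< suc q) (sym (countBelow-zero (toList b))) (s≤s z≤n)))
  go (suc p) le le′ = ok (p , q , ≤-pred le , le′)
allowed-topple (t , b) (bottom j) ok (p , q , le , le′) =
  go q (subst (suc p ≤_) (countBelow-map-suc q t) le) (≤-trans le′ (countBelow-updateAt (suc p) b j _))
  where
  go : ∀ q → suc p ≤ countBelow q (toList t) → suc q ≤ suc (countBelow (suc p) (toList b)) → ⊥
  go zero    le _  = contradiction le (<⇒≱ (subst (_< suc p) (sym (countBelow-zero (toList t))) (s≤s z≤n)))
  go (suc q) le le′ = ok (p , q , le , ≤-pred le′)

allowed-⟶* : ∀ {m n} {c d : Config m n} → c ⟶* d → Allowed c → Allowed d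
allowed-⟶* done         ok = ok
allowed-⟶* (then v _ r) ok = allowed-⟶* r (allowed-topple _ v ok)

allowed-addGrain : ∀ {m n} v (c : Config m n) → Allowed c → Allowed (addGrain v c)
allowed-addGrain (top i)    (t , b) ok (p , q , le , le′) =
  ok (p , q , ≤-trans le (countBelow-updateAt-suc (suc q) t i) , le′)
allowed-addGrain (bottom j) (t , b) ok (p , q , le , le′) =
  ok (p , q , le , ≤-trans le′ (countBelow-updateAt-suc (suc p) b j))

-- By sortedness the entries before position `i` are below `z` as well.
countBelow-sorted : ∀ {k z} {xs : Vec ℕ k} → Linked _≤_ xs →
                    ∀ i → lookup xs i < z → toℕ i < countBelow z (toList xs)
countBelow-sorted {xs = x Vec.∷ xs} ord Fin.zero lt rewrite below-< lt = s≤s z≤n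
countBelow-sorted {xs = x Vec.∷ xs} ord (Fin.suc i) lt
  rewrite below-< (≤-<-trans (Linked-lookup ≤-trans {i = Fin.zero} {Fin.suc i} ord (s≤s z≤n)) lt) =
  s≤s (countBelow-sorted (tail ord) i lt)
  where open import Data.Vec.Relation.Unary.Linked using (tail)

-- Dhar's burning algorithm

module Burning {m n} {t : Vec ℕ m} {b : Vec ℕ n} (sorted : Sorted (t , b)) (ok : Allowed (t , b)) where

  -- The state in which exactly the top vertices i, i + 1, … and the bottom
  -- vertices j, j + 1, … have toppled once after the sink has.
  record Burnt (i j : ℕ) (c : Config m n) : Set where
    field
      {p q} : ℕ
      i+p≡m : i + p ≡ m
      j+q≡n : j + q ≡ n
      top<  : ∀ k → toℕ k < i → grains c (top k) ≡ lookup t k + q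
      top≥  : ∀ k → i ≤ toℕ k → grains c (top k) + j ≡ lookup t k
      bot<  : ∀ l → toℕ l < j → grains c (bottom l) ≡ suc (lookup b l + p)
      bot≥  : ∀ l → j ≤ toℕ l → grains c (bottom l) + i ≡ lookup b l

  i<m : ∀ {i j c} → Burnt (suc i) j c → i < m
  i<m {i} B = subst (i <_) i+p≡m (m≤m+n (suc i) p) where open Burnt B

  j<n : ∀ {i j c} → Burnt i (suc j) c → j < n
  j<n {j = j} B = subst (j <_) j+q≡n (m≤m+n (suc j) q) where open Burnt B

  -- The balance of one toppling: a vertex that held `x` grains, received `q` and gives away
  -- `n = j + q` ends `j` short of `x`. Bottom vertices use it with `i`, `p` and `m`, as the grain
  -- from the sink and the one sent back to it cancel.
  ∸-lemma : ∀ {x j q n} → j ≤ x → j + q ≡ n → (x + q ∸ n) + j ≡ x × n ≤ x + q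
  ∸-lemma {x} {j} {q} j≤x refl = trans (cong (λ y → x + q ∸ y + j) (+-comm j q)) (trans (cong (_+ j)
      (trans (cong (_∸ (q + j)) (+-comm x q)) ([m+n]∸[m+o]≡n∸o q x j))) (m∸n+n≡m j≤x)) , +-monoˡ-≤ q j≤x

  burn-top : ∀ {i j c} (B : Burnt (suc i) j c) → let k = fromℕ< (i<m B) in j ≤ lookup t k →
             Unstable c (top k) × Burnt i j (topple (top k) c)
  burn-top {i} {j} {c@(t′ , b′)} B j≤ = subst (n ≤_) (sym eq) (proj₂ (∸-lemma j≤ j+q≡n)) , record
    { i+p≡m = trans (+-suc i p) i+p≡m
    ; j+q≡n = j+q≡n
    ; top<  = λ k k<i → trans (lookup∘updateAt′ k k₀ (<⇒≢′ k<i) t′) (top< k (m≤n⇒m≤1+n k<i))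
    ; top≥  = top≥′
    ; bot<  = λ l l<j → trans (lookup-map l suc b′) (cong suc (trans (bot< l l<j) (sym (+-suc _ p))))
    ; bot≥  = λ l j≤l → trans (cong (_+ i) (lookup-map l suc b′)) (trans (sym (+-suc _ i)) (bot≥ l j≤l))
    }
    where
    open Burnt B
    k₀ = fromℕ< (i<m B)
    toℕ-k₀ : toℕ k₀ ≡ i
    toℕ-k₀ = Fin.toℕ-fromℕ< (i<m B)
    eq : lookup t′ k₀ ≡ lookup t k₀ + q
    eq = top< k₀ (s≤s (≤-reflexive toℕ-k₀))
    <⇒≢′ : ∀ {k} → toℕ k < i → k ≢ k₀
    <⇒≢′ k<i refl = <-irrefl toℕ-k₀ k<i
    top≥′ : ∀ k → i ≤ toℕ k → lookup (updateAt t′ k₀ (_∸ n)) k + j ≡ lookup t k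
    top≥′ k i≤k with k Fin.≟ k₀
    ... | yes refl = trans (cong (_+ j) (trans (lookup∘updateAt k₀ t′) (cong (_∸ n) eq)))
                           (proj₁ (∸-lemma j≤ j+q≡n))
    ... | no k≢    = trans (cong (_+ j) (lookup∘updateAt′ k k₀ k≢ t′))
                           (top≥ k (≤∧≢⇒< i≤k λ e → k≢ (Fin.toℕ-injective (trans (sym e) (sym toℕ-k₀)))))

  burn-bottom : ∀ {i j c} (B : Burnt i (suc j) c) → let l = fromℕ< (j<n B) in i ≤ lookup b l →
                Unstable c (bottom l) × Burnt i j (topple (bottom l) c)
  burn-bottom {i} {j} {c@(t′ , b′)} B i≤ = subst (suc m ≤_) (sym eq) (s≤s (proj₂ (∸-lemma i≤ i+p≡m))) , record
    { i+p≡m = i+p≡m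
    ; j+q≡n = trans (+-suc j q) j+q≡n
    ; top<  = λ k k<i → trans (lookup-map k suc t′) (trans (cong suc (top< k k<i)) (sym (+-suc _ q)))
    ; top≥  = λ k i≤k → trans (cong (_+ j) (lookup-map k suc t′)) (trans (sym (+-suc _ j)) (top≥ k i≤k))
    ; bot<  = λ l l<j → trans (lookup∘updateAt′ l l₀ (<⇒≢′ l<j) b′) (bot< l (m≤n⇒m≤1+n l<j))
    ; bot≥  = bot≥′
    }
    where
    open Burnt B
    l₀ = fromℕ< (j<n B)
    toℕ-l₀ : toℕ l₀ ≡ j
    toℕ-l₀ = Fin.toℕ-fromℕ< (j<n B)
    eq : lookup b′ l₀ ≡ suc (lookup b l₀ + p)
    eq = bot< l₀ (s≤s (≤-reflexive toℕ-l₀))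
    <⇒≢′ : ∀ {l} → toℕ l < j → l ≢ l₀
    <⇒≢′ l<j refl = <-irrefl toℕ-l₀ l<j
    bot≥′ : ∀ l → j ≤ toℕ l → lookup (updateAt b′ l₀ (_∸ suc m)) l + i ≡ lookup b l
    bot≥′ l j≤l with l Fin.≟ l₀
    ... | yes refl = trans (cong (_+ i) (trans (lookup∘updateAt l₀ b′) (cong (_∸ suc m) eq)))
                           (proj₁ (∸-lemma i≤ i+p≡m))
    ... | no l≢    = trans (cong (_+ i) (lookup∘updateAt′ l l₀ l≢ b′))
                           (bot≥ l (≤∧≢⇒< j≤l λ e → l≢ (Fin.toℕ-injective (trans (sym e) (sym toℕ-l₀)))))

  -- If neither of the last untoppled vertices could topple, then the untoppled vertices
  -- would form a forbidden subconfiguration.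
  burn : ∀ i j {c} → Burnt i j c → c ⟶* (t , b)
  burn-with-top : ∀ i j {c} → (B : Burnt (suc i) j c) → j ≤ lookup t (fromℕ< (i<m B)) → c ⟶* (t , b)
  burn-with-bottom : ∀ i j {c} → (B : Burnt i (suc j) c) → i ≤ lookup b (fromℕ< (j<n B)) → c ⟶* (t , b)

  burn-with-top i j B le with burn-top B le
  ... | u , B′ = then _ u (burn i j B′)

  burn-with-bottom i j B le with burn-bottom B le
  ... | u , B′ = then _ u (burn i j B′)

  burn zero zero {c} B = subst (c ⟶*_) (grains-ext eq) done
    where
    open Burnt B
    eq : ∀ v → grains c v ≡ grains (t , b) v
    eq (top k)    = trans (sym (+-identityʳ _)) (top≥ k z≤n)
    eq (bottom l) = trans (sym (+-identityʳ _)) (bot≥ l z≤n)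
  burn zero    (suc j) B = burn-with-bottom zero j B z≤n
  burn (suc i) zero    B = burn-with-top i zero B z≤n
  burn (suc i) (suc j) B with suc j ≤? lookup t (fromℕ< (i<m B)) | suc i ≤? lookup b (fromℕ< (j<n B))
  ... | yes le | _      = burn-with-top i (suc j) B le
  ... | no _   | yes le = burn-with-bottom (suc i) j B le
  ... | no ≰t  | no ≰b  = ⊥-elim (ok (i , j ,
          subst (_< countBelow (suc j) (toList t)) (Fin.toℕ-fromℕ< (i<m B))
                (countBelow-sorted (proj₁ sorted) _ (≰⇒> ≰t)) ,
          subst (_< countBelow (suc i) (toList b)) (Fin.toℕ-fromℕ< (j<n B))
                (countBelow-sorted (proj₂ sorted) _ (≰⇒> ≰b))))

  burning : fireSink (t , b) ⟶* (t , b)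
  burning = burn m n record
    { i+p≡m = +-identityʳ m
    ; j+q≡n = +-identityʳ n
    ; top<  = λ k _ → sym (+-identityʳ _)
    ; top≥  = λ k m≤k → contradiction m≤k (<⇒≱ (Fin.toℕ<n k))
    ; bot<  = λ l _ → trans (lookup-map l suc b) (cong suc (sym (+-identityʳ _)))
    ; bot≥  = λ l n≤l → contradiction n≤l (<⇒≱ (Fin.toℕ<n l))
    }

-- Rational arithmetic

fromℕℚ : ℕ → ℚ
fromℕℚ zero    = 0ℚ
fromℕℚ (suc k) = 1ℚ ℚ.+ fromℕℚ k

toℚᵘ-fromℕℚ : ∀ k → ℚ.toℚᵘ (fromℕℚ k) ℚᵘ.≃ ℚᵘ.mkℚᵘ (ℤ.+ k) 0
toℚᵘ-fromℕℚ zero    = ℚᵘ.≃-refl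
toℚᵘ-fromℕℚ (suc k) = ℚᵘ.≃-trans (ℚ.toℚᵘ-homo-+ 1ℚ (fromℕℚ k))
  (ℚᵘ.≃-trans (ℚᵘ.+-congʳ ℚᵘ.1ℚᵘ (toℚᵘ-fromℕℚ k))
    (ℚᵘ.*≡* (cong (λ x → (ℤ.1ℤ ℤ.+ x) ℤ.* ℤ.1ℤ) (ℤ.*-identityʳ (ℤ.+ k)))))

1/k*k≡1 : ∀ k .{{_ : NonZero k}} → (ℤ.1ℤ ℚ./ k) ℚ.* fromℕℚ k ≡ 1ℚ
1/k*k≡1 (suc k) = ℚ.toℚᵘ-injective (ℚᵘ.≃-trans (ℚ.toℚᵘ-homo-* (ℤ.1ℤ ℚ./ suc k) (fromℕℚ (suc k)))
  (ℚᵘ.≃-trans (ℚᵘ.*-cong (ℚ.toℚᵘ-fromℚᵘ (ℚᵘ.mkℚᵘ (ℤ.+ 1) k)) (toℚᵘ-fromℕℚ (suc k)))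
    (ℚᵘ.*≡* (cong (λ x → ℤ.+ suc x) (trans (cong (_* 1) (+-identityʳ k)) (sym (+-identityʳ (k * 1))))))))

-- For `r = (a + 1) / (d + 1)` the denominator serves, since `(d + 1) r = a + 1`.
archimedean : ∀ r → 0ℚ ℚ.< r → ∃[ j ] 1ℚ ℚ.≤ fromℕℚ j ℚ.* r
archimedean r@(ℚ.mkℚ (ℤ.+ suc a) d _) _ = suc d , ℚ.toℚᵘ-cancel-≤
  (ℚᵘ.≤-respʳ-≃ (ℚᵘ.≃-sym (ℚᵘ.≃-trans (ℚ.toℚᵘ-homo-* (fromℕℚ (suc d)) r) (ℚᵘ.*-congʳ (toℚᵘ-fromℕℚ (suc d)))))
    (ℚᵘ.*≤* (ℤ.+≤+ le)))
  where
  le : suc (d + 0 + 0) ≤ suc (a + d * suc a) * 1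
  le rewrite *-identityʳ (a + d * suc a) | +-identityʳ (d + 0) | +-identityʳ d =
    s≤s (≤-trans (m≤m*n d (suc a)) (m≤n+m (d * suc a) a))
archimedean (ℚ.mkℚ (ℤ.+ zero) d _) (ℚ.*<* (ℤ.+<+ ()))
archimedean (ℚ.mkℚ ℤ.-[1+ a ] d _) (ℚ.*<* ())

pow : ℚ → ℕ → ℚ
pow x zero    = 1ℚ
pow x (suc k) = x ℚ.* pow x k

*-monoʳ : ∀ {r p q} → 0ℚ ℚ.≤ r → p ℚ.≤ q → r ℚ.* p ℚ.≤ r ℚ.* q
*-monoʳ {r} 0≤r = ℚ.*-monoˡ-≤-nonNeg r {{ℚ.nonNegative 0≤r}}

*-monoˡ : ∀ {r p q} → 0ℚ ℚ.≤ r → p ℚ.≤ q → p ℚ.* r ℚ.≤ q ℚ.* r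
*-monoˡ {r} 0≤r = ℚ.*-monoʳ-≤-nonNeg r {{ℚ.nonNegative 0≤r}}

0≤* : ∀ {p q} → 0ℚ ℚ.≤ p → 0ℚ ℚ.≤ q → 0ℚ ℚ.≤ p ℚ.* q
0≤* {p} 0≤p 0≤q = ℚ.≤-trans (ℚ.≤-reflexive (sym (ℚ.*-zeroʳ p))) (*-monoʳ 0≤p 0≤q)

0<* : ∀ {p q} → 0ℚ ℚ.< p → 0ℚ ℚ.< q → 0ℚ ℚ.< p ℚ.* q
0<* {p} {q} 0<p 0<q =
  ℚ.positive⁻¹ (p ℚ.* q) {{ℚ.pos*pos⇒pos p {{ℚ.positive 0<p}} q {{ℚ.positive 0<q}}}}

0≤1 : 0ℚ ℚ.≤ 1ℚ
0≤1 = ℚ.*≤* (ℤ.+≤+ z≤n)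

0<1 : 0ℚ ℚ.< 1ℚ
0<1 = ℚ.*<* (ℤ.+<+ (s≤s z≤n))

0≤fromℕℚ : ∀ k → 0ℚ ℚ.≤ fromℕℚ k
0≤fromℕℚ zero    = ℚ.≤-refl
0≤fromℕℚ (suc k) = ℚ.+-mono-≤ 0≤1 (0≤fromℕℚ k)

pow-nonneg : ∀ {x} → 0ℚ ℚ.≤ x → ∀ k → 0ℚ ℚ.≤ pow x k
pow-nonneg 0≤x zero    = 0≤1
pow-nonneg 0≤x (suc k) = 0≤* 0≤x (pow-nonneg 0≤x k)

pow-pos : ∀ {x} → 0ℚ ℚ.< x → ∀ k → 0ℚ ℚ.< pow x k
pow-pos 0<x zero    = 0<1
pow-pos 0<x (suc k) = 0<* 0<x (pow-pos 0<x k)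

pow≤1 : ∀ {x} → 0ℚ ℚ.≤ x → x ℚ.≤ 1ℚ → ∀ k → pow x k ℚ.≤ 1ℚ
pow≤1 0≤x x≤1 zero        = ℚ.≤-refl
pow≤1 {x} 0≤x x≤1 (suc k) =
  ℚ.≤-trans (*-monoʳ 0≤x (pow≤1 0≤x x≤1 k)) (ℚ.≤-trans (ℚ.≤-reflexive (ℚ.*-identityʳ x)) x≤1)

0≤1- : ∀ {x} → x ℚ.≤ 1ℚ → 0ℚ ℚ.≤ 1ℚ ℚ.- x
0≤1- {x} x≤1 = ℚ.≤-trans (ℚ.≤-reflexive (sym (ℚ.+-inverseʳ x))) (ℚ.+-monoˡ-≤ (ℚ.- x) x≤1)

≤+nonneg : ∀ {p q} → 0ℚ ℚ.≤ q → p ℚ.≤ p ℚ.+ q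
≤+nonneg {p} 0≤q = ℚ.≤-trans (ℚ.≤-reflexive (sym (ℚ.+-identityʳ p))) (ℚ.+-monoʳ-≤ p 0≤q)

-- (1 − δ)ʲ ≤ 1 / (1 + j δ)
bernoulli : ∀ {δ} → 0ℚ ℚ.≤ δ → δ ℚ.≤ 1ℚ → ∀ j →
            pow (1ℚ ℚ.- δ) j ℚ.* (1ℚ ℚ.+ fromℕℚ j ℚ.* δ) ℚ.≤ 1ℚ
bernoulli {δ} 0≤δ δ≤1 zero    = ℚ.≤-reflexive
  (solve 1 (λ d → con 1ℚ :* (con 1ℚ :+ con 0ℚ :* d) := con 1ℚ) refl δ)
  where open +-*-Solver
bernoulli {δ} 0≤δ δ≤1 (suc j) = begin
  (q ℚ.* Q) ℚ.* (1ℚ ℚ.+ (1ℚ ℚ.+ J) ℚ.* δ)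
    -- The term added is what `(1 - δ)(1 + (1 + j)δ)` lacks to be `1 + jδ`, namely `(1 + j)δ²`.
    ≤⟨ ≤+nonneg (0≤* 0≤Q (0≤* (0≤fromℕℚ (suc j)) (0≤* 0≤δ 0≤δ))) ⟩
  (q ℚ.* Q) ℚ.* (1ℚ ℚ.+ (1ℚ ℚ.+ J) ℚ.* δ) ℚ.+ Q ℚ.* ((1ℚ ℚ.+ J) ℚ.* (δ ℚ.* δ))
    ≡⟨ solve 3 (λ Q J d → ((con 1ℚ :- d) :* Q) :* (con 1ℚ :+ (con 1ℚ :+ J) :* d)
                          :+ Q :* ((con 1ℚ :+ J) :* (d :* d))
                         := Q :* (con 1ℚ :+ J :* d)) refl Q J δ ⟩
  Q ℚ.* (1ℚ ℚ.+ J ℚ.* δ)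
    ≤⟨ bernoulli 0≤δ δ≤1 j ⟩
  1ℚ ∎
  where
  open ℚ.≤-Reasoning
  open +-*-Solver
  q = 1ℚ ℚ.- δ
  Q = pow q j
  J = fromℕℚ j
  0≤Q : 0ℚ ℚ.≤ Q
  0≤Q = pow-nonneg (0≤1- δ≤1) j

pow→0 : ∀ {δ ε} → 0ℚ ℚ.< δ → δ ℚ.≤ 1ℚ → 0ℚ ℚ.< ε → ∃[ j ] pow (1ℚ ℚ.- δ) j ℚ.< ε
-- The product `δ ε` is the right scale: if `jδε` is at least 1, a power `(1 - δ)ʲ` of at least `ε`
-- would push the left side of `bernoulli` above 1.
pow→0 {δ} {ε} 0<δ δ≤1 0<ε with archimedean (δ ℚ.* ε) (0<* 0<δ 0<ε)
... | j , 1≤ = j , ℚ.≰⇒> λ ε≤ → ℚ.<-irrefl refl (begin-strict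
  1ℚ                                              <⟨ ε>0⇒ ⟩
  ε ℚ.+ 1ℚ                                        ≤⟨ ℚ.+-monoʳ-≤ ε 1≤ ⟩
  ε ℚ.+ fromℕℚ j ℚ.* (δ ℚ.* ε)                    ≡⟨ solve 3 (λ J d e → e :+ J :* (d :* e) := e :* (con 1ℚ :+ J :* d))
                                                       refl (fromℕℚ j) δ ε ⟩
  ε ℚ.* (1ℚ ℚ.+ fromℕℚ j ℚ.* δ)                   ≤⟨ *-monoˡ (ℚ.+-mono-≤ 0≤1 (0≤* (0≤fromℕℚ j) 0≤δ)) ε≤ ⟩
  pow (1ℚ ℚ.- δ) j ℚ.* (1ℚ ℚ.+ fromℕℚ j ℚ.* δ)    ≤⟨ bernoulli 0≤δ δ≤1 j ⟩
  1ℚ                                              ∎)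
  where
  open ℚ.≤-Reasoning
  open +-*-Solver
  0≤δ = ℚ.<⇒≤ 0<δ
  ε>0⇒ : 1ℚ ℚ.< ε ℚ.+ 1ℚ
  ε>0⇒ = subst (ℚ._< ε ℚ.+ 1ℚ) (ℚ.+-identityˡ 1ℚ) (ℚ.+-monoˡ-< 1ℚ 0<ε)

-- Expectations

module _ {A : Set} where

  sumℚ : (A → ℚ) → List A → ℚ
  sumℚ f xs = List.foldr ℚ._+_ 0ℚ (List.map f xs)

  sumℚ-mono : ∀ {f g} → (∀ x → f x ℚ.≤ g x) → ∀ xs → sumℚ f xs ℚ.≤ sumℚ g xs
  sumℚ-mono le []       = ℚ.≤-refl
  sumℚ-mono le (x ∷ xs) = ℚ.+-mono-≤ (le x) (sumℚ-mono le xs)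

  sumℚ-nonneg : ∀ {f} → (∀ x → 0ℚ ℚ.≤ f x) → ∀ xs → 0ℚ ℚ.≤ sumℚ f xs
  sumℚ-nonneg le []       = ℚ.≤-refl
  sumℚ-nonneg le (x ∷ xs) = ℚ.+-mono-≤ (le x) (sumℚ-nonneg le xs)

  sumℚ-* : ∀ a f xs → sumℚ (λ x → a ℚ.* f x) xs ≡ a ℚ.* sumℚ f xs
  sumℚ-* a f []       = sym (ℚ.*-zeroʳ a)
  sumℚ-* a f (x ∷ xs) = trans (cong (a ℚ.* f x ℚ.+_) (sumℚ-* a f xs)) (sym (ℚ.*-distribˡ-+ a (f x) (sumℚ f xs)))

  sumℚ-+ : ∀ f g xs → sumℚ (λ x → f x ℚ.+ g x) xs ≡ sumℚ f xs ℚ.+ sumℚ g xs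
  sumℚ-+ f g []       = refl
  sumℚ-+ f g (x ∷ xs) = trans (cong (f x ℚ.+ g x ℚ.+_) (sumℚ-+ f g xs))
    (solve 4 (λ a b c d → (a :+ b) :+ (c :+ d) := (a :+ c) :+ (b :+ d)) refl
      (f x) (g x) (sumℚ f xs) (sumℚ g xs))
    where open +-*-Solver

  sumℚ-1 : ∀ {f} → (∀ x → f x ≡ 1ℚ) → ∀ xs → sumℚ f xs ≡ fromℕℚ (length xs)
  sumℚ-1 eq []       = refl
  sumℚ-1 eq (x ∷ xs) = cong₂ ℚ._+_ (eq x) (sumℚ-1 eq xs)

  ∈⇒≤sumℚ : ∀ {f} → (∀ x → 0ℚ ℚ.≤ f x) → ∀ {x xs} → x ∈ xs → f x ℚ.≤ sumℚ f xs
  ∈⇒≤sumℚ le {xs = x ∷ xs} (here refl) = ≤+nonneg (sumℚ-nonneg le xs)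
  ∈⇒≤sumℚ {f} le {x} {y ∷ xs} (there x∈) =
    ℚ.≤-trans (ℚ.≤-reflexive (sym (ℚ.+-identityˡ (f x)))) (ℚ.+-mono-≤ (le y) (∈⇒≤sumℚ le x∈))

length-vertices : ∀ m n → length (vertices m n) ≡ m + n
length-vertices m n = trans (List.length-++ (List.map top (allFin m)))
  (cong₂ _+_ (trans (List.length-map top (allFin m)) (List.length-tabulate {n = m} (λ i → i)))
             (trans (List.length-map bottom (allFin n)) (List.length-tabulate {n = n} (λ i → i))))

∈-vertices : ∀ {m n} (v : Vertex m n) → v ∈ vertices m n
∈-vertices (top i)    = ∈-++⁺ˡ (∈-map⁺ top (∈-allFin i))
∈-vertices (bottom j) = ∈-++⁺ʳ _ (∈-map⁺ bottom (∈-allFin j))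

module _ {m n : ℕ} .{{_ : NonZero n}} where

  uniform : ℚ
  uniform = ℤ.1ℤ ℚ./ (m + n)

  0<uniform : 0ℚ ℚ.< uniform
  0<uniform = ℚ.positive⁻¹ uniform {{ℚ.normalize-pos 1 (m + n)}}

  0≤uniform : 0ℚ ℚ.≤ uniform
  0≤uniform = ℚ.<⇒≤ 0<uniform

  𝔼-mono : ∀ {f g : Vertex m n → ℚ} → (∀ v → f v ℚ.≤ g v) → 𝔼 f ℚ.≤ 𝔼 g
  𝔼-mono le = *-monoʳ 0≤uniform (sumℚ-mono le (vertices m n))

  𝔼-nonneg : ∀ {f : Vertex m n → ℚ} → (∀ v → 0ℚ ℚ.≤ f v) → 0ℚ ℚ.≤ 𝔼 f
  𝔼-nonneg le = 0≤* 0≤uniform (sumℚ-nonneg le (vertices m n))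

  𝔼-* : ∀ a (f : Vertex m n → ℚ) → 𝔼 (λ v → a ℚ.* f v) ≡ a ℚ.* 𝔼 f
  𝔼-* a f = trans (cong (uniform ℚ.*_) (sumℚ-* a f (vertices m n)))
    (solve 3 (λ p a s → p :* (a :* s) := a :* (p :* s)) refl uniform a (sumℚ f (vertices m n)))
    where open +-*-Solver

  𝔼-+ : ∀ (f g : Vertex m n → ℚ) → 𝔼 (λ v → f v ℚ.+ g v) ≡ 𝔼 f ℚ.+ 𝔼 g
  𝔼-+ f g = trans (cong (uniform ℚ.*_) (sumℚ-+ f g (vertices m n))) (ℚ.*-distribˡ-+ uniform _ _)

  𝔼-1 : ∀ {f : Vertex m n → ℚ} → (∀ v → f v ≡ 1ℚ) → 𝔼 f ≡ 1ℚ
  𝔼-1 eq = trans (cong (uniform ℚ.*_) (trans (sumℚ-1 eq (vertices m n)) (cong fromℕℚ (length-vertices m n))))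
                 (1/k*k≡1 (m + n))

  𝔼-≥ : ∀ {f : Vertex m n → ℚ} → (∀ v → 0ℚ ℚ.≤ f v) → ∀ v → uniform ℚ.* f v ℚ.≤ 𝔼 f
  𝔼-≥ le v = *-monoʳ 0≤uniform (∈⇒≤sumℚ le (∈-vertices v))

  uniform≤1 : Vertex m n → uniform ℚ.≤ 1ℚ
  uniform≤1 v = subst₂ ℚ._≤_ (ℚ.*-identityʳ uniform) (𝔼-1 λ _ → refl) (𝔼-≥ (λ _ → 0≤1) v)

-- Recurrence

  ≤-if : ∀ b {x y z : ℚ} → (z ℚ.≤ x) → (z ℚ.≤ y) → z ℚ.≤ (if b then x else y)
  ≤-if true  z≤x _ = z≤x
  ≤-if false _ z≤y = z≤y

  step-stable : ∀ (d : Config m n) v → Stable (step d v)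
  step-stable d v = stabilise-stable (addGrain v d)

  maximal : Config m n
  maximal = Vec.replicate m (pred n) , Vec.replicate n m

  maximal-stable : Stable maximal
  maximal-stable (top i)    = subst (_< n) (sym (Vec.lookup-replicate i (pred n))) (≤-reflexive (suc-pred n))
  maximal-stable (bottom j) = subst (_< suc m) (sym (Vec.lookup-replicate j m)) ≤-refl

  -- Bottom vertices with at most `a` grains are needed, but all hold `m`; so `a ≥ m`, and then
  -- there are too few top vertices.
  maximal-allowed : Allowed maximal
  maximal-allowed (a , b , le , le′) with suc a ≤? m
  ... | yes a<m = n≮0 (subst (suc b ≤_) (countBelow-replicate n a<m) le′)
  ... | no a≮m  = a≮m (≤-trans le (≤-trans (countBelow≤length (suc b) (toList (Vec.replicate m (pred n))))
                                    (≤-reflexive (Vec.length-toList (Vec.replicate m (pred n))))))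

  module _ (c : Config m n) where

    -- The complement of `hitProb` as a recursion of its own: a hit contributes 0, so that a common
    -- factor can be drawn out of the expectation.
    missProb : ℕ → Config m n → ℚ
    missProb zero    d = 1ℚ
    missProb (suc k) d = 𝔼 λ v → if does (step d v ≟ᶜ c) then 0ℚ else missProb k (step d v)

    hit+miss : ∀ k d → hitProb c k d ℚ.+ missProb k d ≡ 1ℚ
    hit+miss zero    d = refl
    hit+miss (suc k) d = trans (sym (𝔼-+ _ _)) (𝔼-1 λ v → lemma (does (step d v ≟ᶜ c)) (hit+miss k (step d v)))
      where
      lemma : ∀ b {x y} → x ℚ.+ y ≡ 1ℚ → (if b then 1ℚ else x) ℚ.+ (if b then 0ℚ else y) ≡ 1ℚ
      lemma true  _  = refl
      lemma false eq = eq

    hit≡1-miss : ∀ k d → hitProb c k d ≡ 1ℚ ℚ.- missProb k d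
    hit≡1-miss k d = trans (solve 2 (λ h x → h := (h :+ x) :- x) refl (hitProb c k d) (missProb k d))
                           (cong (ℚ._- missProb k d) (hit+miss k d))
      where open +-*-Solver

    miss≡1-hit : ∀ k d → missProb k d ≡ 1ℚ ℚ.- hitProb c k d
    miss≡1-hit k d = trans (solve 2 (λ h x → x := (h :+ x) :- h) refl (hitProb c k d) (missProb k d))
                           (cong (ℚ._- hitProb c k d) (hit+miss k d))
      where open +-*-Solver

    hit-nonneg : ∀ k d → 0ℚ ℚ.≤ hitProb c k d
    hit-nonneg zero    d = ℚ.≤-refl
    hit-nonneg (suc k) d = 𝔼-nonneg λ v → ≤-if (does (step d v ≟ᶜ c)) 0≤1 (hit-nonneg k (step d v))

    miss-nonneg : ∀ k d → 0ℚ ℚ.≤ missProb k d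
    miss-nonneg zero    d = 0≤1
    miss-nonneg (suc k) d = 𝔼-nonneg λ v → ≤-if (does (step d v ≟ᶜ c)) ℚ.≤-refl (miss-nonneg k (step d v))

    -- Markov property: the state reached after `k` steps without a hit is stable, whatever it is,
    -- so the remaining `l` steps miss with probability at most `a`.
    miss-+ : ∀ {l a} → (∀ d → Stable d → missProb l d ℚ.≤ a) →
             ∀ k d → Stable d → missProb (k + l) d ℚ.≤ a ℚ.* missProb k d
    miss-+ {l} {a} bound zero    d st = ℚ.≤-trans (bound d st) (ℚ.≤-reflexive (sym (ℚ.*-identityʳ a)))
    miss-+ {l} {a} bound (suc k) d st = ℚ.≤-trans
      (𝔼-mono λ v → lemma (does (step d v ≟ᶜ c)) (miss-+ bound k (step d v) (step-stable d v)))
      (ℚ.≤-reflexive (𝔼-* a _))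
      where
      lemma : ∀ b {x y} → x ℚ.≤ a ℚ.* y → (if b then 0ℚ else x) ℚ.≤ a ℚ.* (if b then 0ℚ else y)
      lemma true  _  = ℚ.≤-reflexive (sym (ℚ.*-zeroʳ a))
      lemma false le = le

    miss-geometric : ∀ {l a} → 0ℚ ℚ.≤ a → (∀ d → Stable d → missProb l d ℚ.≤ a) →
                     ∀ j → ∃[ k ] ∀ d → Stable d → missProb k d ℚ.≤ pow a j
    miss-geometric 0≤a bound zero = 0 , λ _ _ → ℚ.≤-refl
    miss-geometric {l} 0≤a bound (suc j) with miss-geometric {l} 0≤a bound j
    ... | k , le = k + l , λ d st → ℚ.≤-trans (miss-+ {l} bound k d st) (*-monoʳ 0≤a (le d st))

    -- Each vertex of the prescribed list is drawn with probability `uniform`. The number of steps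
    -- may exceed the length of the list, so that one bound serves all starting states; if `c` is
    -- hit early, the bound holds because powers of `uniform` are at most 1.
    hit-lower : Stable c → ∀ k v vs d → addGrains (v ∷ vs) d ⟶* c → length vs ≤ k →
                pow uniform (suc k) ℚ.≤ hitProb c (suc k) d
    hit-lower st k v vs d r len = ℚ.≤-trans (*-monoʳ 0≤uniform at-v)
        (𝔼-≥ (λ w → ≤-if (does (step d w ≟ᶜ c)) 0≤1 (hit-nonneg k (step d w))) v)
      where
      r′ : addGrains vs (step d v) ⟶* c
      -- By confluence, stabilising before all grains are added does not change the outcome.
      r′ = ⟶*-confluent (addGrains-⟶* vs (stabilise-⟶* (addGrain v d))) r st
      at-v : pow uniform k ℚ.≤ (if does (step d v ≟ᶜ c) then 1ℚ else hitProb c k (step d v))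
      at-v with step d v ≟ᶜ c
      ... | yes _ = pow≤1 0≤uniform (uniform≤1 v) k
      ... | no ≢c = later vs k len r′
        where
        later : ∀ vs k → length vs ≤ k → addGrains vs (step d v) ⟶* c → pow uniform k ℚ.≤ hitProb c k (step d v)
        -- No grains are left: a stable state that topples to `c` is `c` itself.
        later []       k       _         r = contradiction (stable-⟶* (step-stable d v) r) ≢c
        later (w ∷ ws) (suc k) (s≤s len) r = hit-lower st k w ws (step d v) r len

    -- Every stable d lies below a configuration that topples to c.
    returns⇒recurrent : Stable c → fireSink c ⟶* c → Vertex m n → RecurrentState c
    returns⇒recurrent st burn v₀ ε 0<ε with full burn
    ... | x , x⟶c , unst = k , subst (1ℚ ℚ.- ε ℚ.<_) (sym (hit≡1-miss k c))
            (ℚ.+-monoʳ-< 1ℚ (ℚ.neg-antimono-< (ℚ.≤-<-trans (proj₂ geo c st) (proj₂ small))))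
      where
      -- Every stable `d` lies below `x`, so the grains of `x` bound the number to be added,
      -- uniformly in `d`.
      K = total x
      δ = pow uniform (suc K)
      hits : ∀ d → Stable d → δ ℚ.≤ hitProb c (suc K) d
      hits d std with ≤⇒addGrains d x (λ v → <⇒≤ (<-≤-trans (std v) (unst v)))
      -- With nothing to add, `d` would be `x`, which is unstable at `v₀`.
      ... | []     , refl = contradiction (unst v₀) (<⇒≱ (std v₀))
      ... | v ∷ vs , eq   = hit-lower st K v vs d (subst (_⟶* c) (sym eq) x⟶c)
        (≤-trans (n≤1+n _) (≤-trans (m≤m+n _ (total d))
          (≤-reflexive (trans (sym (total-addGrains (v ∷ vs) d)) (cong total eq)))))
      δ≤1 : δ ℚ.≤ 1ℚ
      δ≤1 = pow≤1 0≤uniform (uniform≤1 v₀) (suc K)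
      small = pow→0 (pow-pos 0<uniform (suc K)) δ≤1 0<ε
      geo = miss-geometric {suc K} {1ℚ ℚ.- δ} (0≤1- δ≤1)
        (λ d std → ℚ.≤-trans (ℚ.≤-reflexive (miss≡1-hit (suc K) d))
                             (ℚ.+-monoʳ-≤ 1ℚ (ℚ.neg-antimono-≤ (hits d std))))
        (proj₁ small)
      k = proj₁ geo

    allowed-step : ∀ (d : Config m n) v → Allowed d → Allowed (step d v)
    allowed-step d v ok = allowed-⟶* {c = addGrain v d} {step d v}
      (stabilise-⟶* (addGrain v d)) (allowed-addGrain v d ok)

    miss-allowed : ¬ Allowed c → ∀ k d → Allowed d → missProb k d ≡ 1ℚ
    miss-allowed ¬ok zero    d ok = refl
    miss-allowed ¬ok (suc k) d ok = 𝔼-1 eq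
      where
      eq : ∀ v → (if does (step d v ≟ᶜ c) then 0ℚ else missProb k (step d v)) ≡ 1ℚ
      eq v with step d v ≟ᶜ c
      ... | yes refl = contradiction (allowed-step d v ok) ¬ok
      ... | no _     = miss-allowed ¬ok k (step d v) (allowed-step d v ok)

    -- The grains of `vs` cause no toppling, and each makes the state exceed `c` at some vertex, so
    -- `c` is not hit on the way. From the allowed state then reached it never is, whence a bound
    -- independent of `k`.
    miss-lower : ¬ Allowed c → ∀ vs k d → (∀ v → grains c v ≤ grains d v) →
                 Stable (addGrains vs d) → Allowed (addGrains vs d) → pow uniform (length vs) ℚ.≤ missProb k d
    miss-lower ¬ok []       k       d c≤d st ok = ℚ.≤-reflexive (sym (miss-allowed ¬ok k d ok))
    miss-lower ¬ok (v ∷ vs) zero    d c≤d st ok = pow≤1 0≤uniform (uniform≤1 v) (suc (length vs))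
    miss-lower ¬ok (v ∷ vs) (suc k) d c≤d st ok = ℚ.≤-trans (*-monoʳ 0≤uniform at-v)
        (𝔼-≥ (λ w → ≤-if (does (step d w ≟ᶜ c)) ℚ.≤-refl (miss-nonneg k (step d w))) v)
      where
      d′ = addGrain v d
      step≡ : step d v ≡ d′
      step≡ = sym (stable-⟶* (λ w → ≤-<-trans (grains-addGrains-≤ vs d′ w) (st w)) (stabilise-⟶* d′))
      at-v : pow uniform (length vs) ℚ.≤ (if does (step d v ≟ᶜ c) then 0ℚ else missProb k (step d v))
      at-v with step d v ≟ᶜ c
      ... | yes refl = contradiction (c≤d v) (<⇒≱ (≤-reflexive
              (trans (sym (grains-addGrain-≡ v d)) (cong (λ e → grains e v) (sym step≡)))))
      ... | no _ rewrite step≡ = miss-lower ¬ok vs k d′ (λ w → ≤-trans (c≤d w) (grains-addGrain-≤ v d w)) st ok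

    recurrent⇒allowed : Stable c → RecurrentState c → Allowed c
    recurrent⇒allowed st rec forbidden with ≤⇒addGrains c maximal c≤max
      where
      c≤max : ∀ v → grains c v ≤ grains maximal v
      c≤max (top i)    = subst (grains c (top i) ≤_) (sym (Vec.lookup-replicate i (pred n)))
                           (≤-pred (subst (grains c (top i) <_) (sym (suc-pred n)) (st (top i))))
      c≤max (bottom j) = subst (grains c (bottom j) ≤_) (sym (Vec.lookup-replicate j m)) (≤-pred (st (bottom j)))
    ... | vs , eq = ℚ.<-irrefl refl (ℚ.<-≤-trans miss< (miss-lower (λ ok → ok forbidden) vs k c (λ _ → ≤-refl)
                      (subst Stable (sym eq) maximal-stable) (subst Allowed (sym eq) maximal-allowed)))
      where
      -- The lower bound on the miss probability is itself taken as the tolerance, which recurrence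
      -- would have to beat.
      small = rec (pow uniform (length vs)) (pow-pos 0<uniform (length vs))
      k = proj₁ small
      miss< : missProb k c ℚ.< pow uniform (length vs)
      miss< = subst₂ ℚ._<_ (sym (miss≡1-hit k c))
        (solve 1 (λ e → con 1ℚ :- (con 1ℚ :- e) := e) refl (pow uniform (length vs)))
        (ℚ.+-monoʳ-< 1ℚ (ℚ.neg-antimono-< (proj₂ small)))
        where open +-*-Solver

-- Numbers and heights of steps in lattice paths

#E #N : LatticePath → ℕ
#E p = proj₁ (end p)
#N p = proj₂ (end p)

#E-++ : ∀ p q → #E (p ++ q) ≡ #E p + #E q
#E-++ []      q = refl
#E-++ (N ∷ p) q = #E-++ p q
#E-++ (E ∷ p) q = cong suc (#E-++ p q)

#N-++ : ∀ p q → #N (p ++ q) ≡ #N p + #N q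
#N-++ []      q = refl
#N-++ (N ∷ p) q = cong suc (#N-++ p q)
#N-++ (E ∷ p) q = #N-++ p q

#E+#N≡length : ∀ p → #E p + #N p ≡ length p
#E+#N≡length []      = refl
#E+#N≡length (N ∷ p) = trans (+-suc _ _) (cong suc (#E+#N≡length p))
#E+#N≡length (E ∷ p) = cong suc (#E+#N≡length p)

end⇒length : ∀ {a b} p → end p ≡ (a , b) → length p ≡ a + b
end⇒length p refl = sym (#E+#N≡length p)

equal-#E : ∀ p q → length p ≡ length q → #N p ≡ #N q → #E p ≡ #E q
equal-#E p q len eqN = +-cancelʳ-≡ (#N p) _ _ (begin
  #E p + #N p    ≡⟨ #E+#N≡length p ⟩
  length p       ≡⟨ len ⟩
  length q       ≡⟨ sym (#E+#N≡length q) ⟩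
  #E q + #N q    ≡⟨ cong (#E q +_) (sym eqN) ⟩
  #E q + #N p    ∎)
  where open ≡-Reasoning

#N-E∷ʳ : ∀ p → #N (p ++ [ E ]) ≡ #N p
#N-E∷ʳ p = trans (#N-++ p [ E ]) (+-identityʳ _)

#E-E∷ʳ : ∀ p → #E (p ++ [ E ]) ≡ suc (#E p)
#E-E∷ʳ p = trans (#E-++ p [ E ]) (+-comm _ 1)

#N-N∷ʳ : ∀ p → #N (p ++ [ N ]) ≡ suc (#N p)
#N-N∷ʳ p = trans (#N-++ p [ N ]) (+-comm _ 1)

#E-N∷ʳ : ∀ p → #E (p ++ [ N ]) ≡ #E p
#E-N∷ʳ p = trans (#E-++ p [ N ]) (+-identityʳ _)

-- Reflecting them in the diagonal, lower paths are handled like upper ones.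
opposite : Step → Step
opposite N = E
opposite E = N

reflect : LatticePath → LatticePath
reflect = List.map opposite

reflect-involutive : ∀ p → reflect (reflect p) ≡ p
reflect-involutive []      = refl
reflect-involutive (N ∷ p) = cong (N ∷_) (reflect-involutive p)
reflect-involutive (E ∷ p) = cong (E ∷_) (reflect-involutive p)

#N-reflect : ∀ p → #N (reflect p) ≡ #E p
#N-reflect []      = refl
#N-reflect (N ∷ p) = #N-reflect p
#N-reflect (E ∷ p) = cong suc (#N-reflect p)

#E-reflect : ∀ p → #E (reflect p) ≡ #N p
#E-reflect []      = refl
#E-reflect (N ∷ p) = cong suc (#E-reflect p)
#E-reflect (E ∷ p) = #E-reflect p

-- For the upper path of a word these are the top entries, for its reflected lower path the bottom
-- entries except the last.
heights : ℕ → LatticePath → List ℕ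
heights x []      = []
heights x (N ∷ p) = heights (suc x) p
heights x (E ∷ p) = x ∷ heights x p

length-heights : ∀ x p → length (heights x p) ≡ #E p
length-heights x []      = refl
length-heights x (N ∷ p) = length-heights (suc x) p
length-heights x (E ∷ p) = cong suc (length-heights x p)

-- The `E` step after `p` and the `#E p` ones inside `p` all occur at heights at most `x + #N p`.
countBelow-heights : ∀ x p q → #E p < countBelow (suc (x + #N p)) (heights x (p ++ E ∷ q))
countBelow-heights x [] q rewrite below-< (s≤s (m≤m+n x 0)) = s≤s z≤n
countBelow-heights x (N ∷ p) q rewrite +-suc x (#N p) = countBelow-heights (suc x) p q
countBelow-heights x (E ∷ p) q rewrite below-< (s≤s (m≤m+n x (#N p))) = s≤s (countBelow-heights x p q)

-- Weakly increasing lists with entries in an interval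

data Increasing (k : ℕ) : ℕ → List ℕ → Set where
  []  : ∀ {x} → x ≤ k → Increasing k x []
  _∷_ : ∀ {x y ys} → x ≤ y → Increasing k y ys → Increasing k x (y ∷ ys)

module _ {k : ℕ} where

  increasing-≤ : ∀ {x xs} → Increasing k x xs → x ≤ k
  increasing-≤ ([] x≤k)   = x≤k
  increasing-≤ (x≤y ∷ ys) = ≤-trans x≤y (increasing-≤ ys)

  increasing-weaken : ∀ {x y xs} → x ≤ y → Increasing k y xs → Increasing k x xs
  increasing-weaken x≤y ([] y≤k)   = [] (≤-trans x≤y y≤k)
  increasing-weaken x≤y (y≤z ∷ zs) = ≤-trans x≤y y≤z ∷ zs

  increasing-∷ʳ⁺ : ∀ {x xs} → Increasing k x xs → Increasing k x (xs ++ [ k ])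
  increasing-∷ʳ⁺ ([] x≤k)   = x≤k ∷ [] ≤-refl
  increasing-∷ʳ⁺ (x≤y ∷ ys) = x≤y ∷ increasing-∷ʳ⁺ ys

  increasing-∷ʳ⁻ : ∀ {x y} xs → Increasing k x (xs ++ [ y ]) → Increasing y x xs × y ≤ k
  increasing-∷ʳ⁻ []       (x≤y ∷ [] y≤k) = [] x≤y , y≤k
  increasing-∷ʳ⁻ (z ∷ xs) (x≤z ∷ zs) with increasing-∷ʳ⁻ xs zs
  ... | xs′ , y≤k = x≤z ∷ xs′ , y≤k

  countBelow-increasing-> : ∀ {x xs z} → Increasing k x xs → k < z → countBelow z xs ≡ length xs
  countBelow-increasing-> ([] _)   k<z = refl
  countBelow-increasing-> (_ ∷ ys) k<z rewrite below-< (≤-<-trans (increasing-≤ ys) k<z) =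
    cong suc (countBelow-increasing-> ys k<z)

  countBelow-increasing-≤ : ∀ {x xs z} → Increasing k x xs → z ≤ x → countBelow z xs ≡ 0
  countBelow-increasing-≤ ([] _)     z≤x = refl
  countBelow-increasing-≤ (x≤y ∷ ys) z≤x rewrite below-≥ (≤-trans z≤x x≤y) =
    countBelow-increasing-≤ ys (≤-trans z≤x x≤y)

  increasing⇒linked : ∀ {x r} (xs : Vec ℕ r) → Increasing k x (toList xs) → Linked _≤_ xs
  increasing⇒linked Vec.[]               _              = []
  increasing⇒linked (y Vec.∷ Vec.[])     _              = [-]
  increasing⇒linked (y Vec.∷ z Vec.∷ xs) (_ ∷ y≤z ∷ zs) = y≤z ∷ increasing⇒linked (z Vec.∷ xs) (y≤z ∷ zs)

  increasing⇒lookup≤ : ∀ {x r} (xs : Vec ℕ r) → Increasing k x (toList xs) → ∀ i → lookup xs i ≤ k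
  increasing⇒lookup≤ (y Vec.∷ xs) (_ ∷ ys) Fin.zero    = increasing-≤ ys
  increasing⇒lookup≤ (y Vec.∷ xs) (_ ∷ ys) (Fin.suc i) = increasing⇒lookup≤ xs ys i

  linked⇒increasing : ∀ {r} {xs : Vec ℕ r} → Linked _≤_ xs → (∀ i → lookup xs i ≤ k) →
                      Increasing k 0 (toList xs)
  linked⇒increasing []          le = [] z≤n
  linked⇒increasing [-]         le = z≤n ∷ [] (le Fin.zero)
  linked⇒increasing {xs = x Vec.∷ y Vec.∷ xs} (x≤y ∷ ys) le with linked⇒increasing ys (le ∘ Fin.suc)
  ... | _ ∷ inc = z≤n ∷ x≤y ∷ inc

increasing-heights : ∀ {x k} p → x + #N p ≡ k → Increasing k x (heights x p)
increasing-heights {x} []      eq = [] (≤-reflexive (trans (sym (+-identityʳ x)) eq))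
increasing-heights {x} (N ∷ p) eq =
  increasing-weaken (n≤1+n x) (increasing-heights p (trans (sym (+-suc x (#N p))) eq))
increasing-heights     (E ∷ p) eq = ≤-refl ∷ increasing-heights p eq

-- Paths determined by the heights of their E steps

replicate-∷ : ∀ {A : Set} k (x : A) ys → replicate k x ++ x ∷ ys ≡ replicate (suc k) x ++ ys
replicate-∷ zero    x ys = refl
replicate-∷ (suc k) x ys = cong (x ∷_) (replicate-∷ k x ys)

heights-replicate : ∀ r x p → heights x (replicate r N ++ p) ≡ heights (r + x) p
heights-replicate zero    x p = refl
heights-replicate (suc r) x p = trans (heights-replicate r (suc x) p) (cong (λ y → heights y p) (+-suc r x))

#N-replicate : ∀ r → #N (replicate r N) ≡ r
#N-replicate zero    = refl
#N-replicate (suc r) = cong suc (#N-replicate r)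

heights-pathVia : ∀ {k x xs} → Increasing k x xs → heights x (pathVia N E k x xs) ≡ xs
heights-pathVia {k} {x} ([] x≤k) =
  trans (cong (heights x) (sym (List.++-identityʳ (replicate (k ∸ x) N)))) (heights-replicate (k ∸ x) x [])
heights-pathVia {k} {x} {y ∷ ys} (x≤y ∷ inc) =
  trans (heights-replicate (y ∸ x) x _)
        (trans (cong (λ z → heights z (E ∷ pathVia N E k y ys)) (m∸n+n≡m x≤y))
               (cong (y ∷_) (heights-pathVia inc)))

#N-pathVia : ∀ {k x xs} → Increasing k x xs → #N (pathVia N E k x xs) + x ≡ k
#N-pathVia {k} {x} ([] x≤k) = trans (cong (_+ x) (#N-replicate (k ∸ x))) (m∸n+n≡m x≤k)
#N-pathVia {k} {x} {y ∷ ys} (x≤y ∷ inc) = begin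
  #N (replicate (y ∸ x) N ++ E ∷ q) + x      ≡⟨ cong (_+ x) (#N-++ (replicate (y ∸ x) N) (E ∷ q)) ⟩
  #N (replicate (y ∸ x) N) + #N q + x        ≡⟨ cong (λ z → z + #N q + x) (#N-replicate (y ∸ x)) ⟩
  y ∸ x + #N q + x                           ≡⟨ cong (_+ x) (+-comm (y ∸ x) (#N q)) ⟩
  #N q + (y ∸ x) + x                         ≡⟨ +-assoc (#N q) (y ∸ x) x ⟩
  #N q + (y ∸ x + x)                         ≡⟨ cong (#N q +_) (m∸n+n≡m x≤y) ⟩
  #N q + y                                   ≡⟨ #N-pathVia inc ⟩
  k                                          ∎
  where
  open ≡-Reasoning
  q = pathVia N E k y ys

-- `pathVia` emits its `N` steps only on reaching the next `E`, so the induction carries the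
-- `suc a ∸ x` of them that are still owed. The shift by `suc` accounts for the leading `N`, the
-- appended `l` for the final `E`.
pathVia-frame : ∀ {l x} a p → x ≤ suc a → l ≡ suc (a + #N p) →
                pathVia N E l x (List.map suc (heights a p) ++ [ l ]) ≡
                replicate (suc a ∸ x) N ++ p ++ [ E ]
pathVia-frame {l} {x} a [] x≤ eq rewrite eq | +-identityʳ a | n∸n≡0 a = refl
pathVia-frame {l} {x} a (N ∷ p) x≤ eq =
  trans (pathVia-frame (suc a) p (m≤n⇒m≤1+n x≤) (trans eq (cong suc (+-suc a (#N p)))))
        (trans (cong (λ r → replicate r N ++ p ++ [ E ]) (+-∸-assoc 1 x≤))
               (sym (replicate-∷ (suc a ∸ x) N (p ++ [ E ]))))
pathVia-frame {l} {x} a (E ∷ p) x≤ eq =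
  cong (λ q → replicate (suc a ∸ x) N ++ E ∷ q)
    (trans (pathVia-frame a p ≤-refl eq) (cong (λ r → replicate r N ++ p ++ [ E ]) (n∸n≡0 (suc a))))

reflect-replicate : ∀ r s → reflect (replicate r s) ≡ replicate r (opposite s)
reflect-replicate r s = List.map-replicate opposite r s

reflect-pathVia : ∀ l x xs → reflect (pathVia N E l x xs) ≡ pathVia E N l x xs
reflect-pathVia l x []       = reflect-replicate (l ∸ x) N
reflect-pathVia l x (y ∷ ys) =
  trans (List.map-++ opposite (replicate (y ∸ x) N) _)
        (cong₂ (λ p q → p ++ N ∷ q) (reflect-replicate (y ∸ x) N) (reflect-pathVia l y ys))

-- The two paths encoded by a labelled path

topStep bottomStep : MStep → Step
topStep U  = N
topStep Hᴺ = N
topStep Hᴱ = E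
topStep D  = E
bottomStep U  = E
bottomStep Hᴺ = N
bottomStep Hᴱ = E
bottomStep D  = N

topPath bottomPath : List MStep → LatticePath
topPath    = List.map topStep
bottomPath = List.map bottomStep

framed : List MStep → LatticePath × LatticePath
framed w = N ∷ topPath w ++ [ E ] , E ∷ bottomPath w ++ [ N ]

zipWith-label : ∀ w → zipWith label (topPath w) (bottomPath w) ≡ w
zipWith-label []       = refl
zipWith-label (U  ∷ w) = cong (U ∷_) (zipWith-label w)
zipWith-label (Hᴺ ∷ w) = cong (Hᴺ ∷_) (zipWith-label w)
zipWith-label (Hᴱ ∷ w) = cong (Hᴱ ∷_) (zipWith-label w)
zipWith-label (D  ∷ w) = cong (D ∷_) (zipWith-label w)

zipWith-paths : ∀ u ℓ → length u ≡ length ℓ →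
                topPath (zipWith label u ℓ) ≡ u × bottomPath (zipWith label u ℓ) ≡ ℓ
zipWith-paths []      []      eq = refl , refl
zipWith-paths (s ∷ u) (r ∷ ℓ) eq with zipWith-paths u ℓ (suc-injective eq)
zipWith-paths (N ∷ u) (N ∷ ℓ) eq | p , q = cong (N ∷_) p , cong (N ∷_) q
zipWith-paths (N ∷ u) (E ∷ ℓ) eq | p , q = cong (N ∷_) p , cong (E ∷_) q
zipWith-paths (E ∷ u) (N ∷ ℓ) eq | p , q = cong (E ∷_) p , cong (N ∷_) q
zipWith-paths (E ∷ u) (E ∷ ℓ) eq | p , q = cong (E ∷_) p , cong (E ∷_) q

topEntries≡heights : ∀ a w → topEntries a w ≡ heights a (topPath w)
topEntries≡heights a []       = refl
topEntries≡heights a (U  ∷ w) = topEntries≡heights (suc a) w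
topEntries≡heights a (Hᴺ ∷ w) = topEntries≡heights (suc a) w
topEntries≡heights a (Hᴱ ∷ w) = cong (a ∷_) (topEntries≡heights a w)
topEntries≡heights a (D  ∷ w) = cong (a ∷_) (topEntries≡heights a w)

bottomEntries≡heights : ∀ a w → bottomEntries a w ≡ heights a (reflect (bottomPath w))
bottomEntries≡heights a []       = refl
bottomEntries≡heights a (U  ∷ w) = bottomEntries≡heights (suc a) w
bottomEntries≡heights a (Hᴱ ∷ w) = bottomEntries≡heights (suc a) w
bottomEntries≡heights a (Hᴺ ∷ w) = cong (a ∷_) (bottomEntries≡heights a w)
bottomEntries≡heights a (D  ∷ w) = cong (a ∷_) (bottomEntries≡heights a w)

#U,Hᴱ≡#E : ∀ w → #U,Hᴱ w ≡ #E (bottomPath w)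
#U,Hᴱ≡#E []       = refl
#U,Hᴱ≡#E (U  ∷ w) = cong suc (#U,Hᴱ≡#E w)
#U,Hᴱ≡#E (Hᴱ ∷ w) = cong suc (#U,Hᴱ≡#E w)
#U,Hᴱ≡#E (Hᴺ ∷ w) = #U,Hᴱ≡#E w
#U,Hᴱ≡#E (D  ∷ w) = #U,Hᴱ≡#E w

walk-#N : ∀ {h w h′} → Walk h w h′ → h + #N (topPath w) ≡ h′ + #N (bottomPath w)
walk-#N []                   = refl
walk-#N {h} (up p)           = trans (+-suc h _) (walk-#N p)
walk-#N {h′ = h′} (down p)   = trans (cong suc (walk-#N p)) (sym (+-suc h′ _))
walk-#N {h} {h′ = h′} (horᴺ p) = trans (+-suc h _) (trans (cong suc (walk-#N p)) (sym (+-suc h′ _)))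
walk-#N (horᴱ p)             = walk-#N p

length-map-∷ʳ : ∀ {A B : Set} (f : A → B) w x → length (List.map f w ++ [ x ]) ≡ suc (length w)
length-map-∷ʳ f w x = trans (List.length-++ (List.map f w)) (trans (+-comm _ 1) (cong suc (List.length-map f w)))

-- The right side exceeds the left by the height after `k` steps. The appended `N` and `E` lie
-- beyond `k`; they give the paths the form they have in `framed`.
walk-prefix : ∀ {h w} → Walk h w 0 → ∀ k → k ≤ length w →
              #N (take k (bottomPath w ++ [ N ])) ≤ h + #N (take k (topPath w ++ [ E ]))
walk-prefix p            zero    _        = z≤n
walk-prefix {h} (up p)   (suc k) (s≤s k≤) = ≤-trans (walk-prefix p k k≤) (≤-reflexive (sym (+-suc h _)))
walk-prefix (down p)     (suc k) (s≤s k≤) = s≤s (walk-prefix p k k≤)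
walk-prefix {h} (horᴺ p) (suc k) (s≤s k≤) = ≤-trans (s≤s (walk-prefix p k k≤)) (≤-reflexive (sym (+-suc h _)))
walk-prefix (horᴱ p)     (suc k) (s≤s k≤) = walk-prefix p k k≤

-- `h` is the lead in `N` steps that the upper path starts with, so the last condition says that the
-- walk has come down to height 0, where the next label is `D`.
Crossing : ℕ → LatticePath → LatticePath → Set
Crossing h u ℓ = ∃[ u₁ ] ∃[ u₂ ] ∃[ ℓ₁ ] ∃[ ℓ₂ ]
  u ≡ u₁ ++ E ∷ u₂ × ℓ ≡ ℓ₁ ++ N ∷ ℓ₂ × length u₁ ≡ length ℓ₁ × h + #N u₁ ≡ #N ℓ₁

walk-or-crossing : ∀ h u ℓ → length u ≡ length ℓ →
                   (∃[ h′ ] Walk h (zipWith label u ℓ) h′) ⊎ Crossing h u ℓ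
walk-or-crossing h []      []      eq = inj₁ (h , [])
walk-or-crossing h (N ∷ u) (E ∷ ℓ) eq with walk-or-crossing (suc h) u ℓ (suc-injective eq)
... | inj₁ (h′ , p) = inj₁ (h′ , up p)
... | inj₂ (u₁ , u₂ , ℓ₁ , ℓ₂ , equ , eqℓ , len , eqN) =
  inj₂ (N ∷ u₁ , u₂ , E ∷ ℓ₁ , ℓ₂ , cong (N ∷_) equ , cong (E ∷_) eqℓ , cong suc len , trans (+-suc h _) eqN)
walk-or-crossing h (N ∷ u) (N ∷ ℓ) eq with walk-or-crossing h u ℓ (suc-injective eq)
... | inj₁ (h′ , p) = inj₁ (h′ , horᴺ p)
... | inj₂ (u₁ , u₂ , ℓ₁ , ℓ₂ , equ , eqℓ , len , eqN) =
  inj₂ (N ∷ u₁ , u₂ , N ∷ ℓ₁ , ℓ₂ , cong (N ∷_) equ , cong (N ∷_) eqℓ , cong suc len ,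
        trans (+-suc h _) (cong suc eqN))
walk-or-crossing h (E ∷ u) (E ∷ ℓ) eq with walk-or-crossing h u ℓ (suc-injective eq)
... | inj₁ (h′ , p) = inj₁ (h′ , horᴱ p)
... | inj₂ (u₁ , u₂ , ℓ₁ , ℓ₂ , equ , eqℓ , len , eqN) =
  inj₂ (E ∷ u₁ , u₂ , E ∷ ℓ₁ , ℓ₂ , cong (E ∷_) equ , cong (E ∷_) eqℓ , cong suc len , eqN)
walk-or-crossing zero    (E ∷ u) (N ∷ ℓ) eq = inj₂ ([] , u , [] , ℓ , refl , refl , refl , refl)
walk-or-crossing (suc h) (E ∷ u) (N ∷ ℓ) eq with walk-or-crossing h u ℓ (suc-injective eq)
... | inj₁ (h′ , p) = inj₁ (h′ , down p)
... | inj₂ (u₁ , u₂ , ℓ₁ , ℓ₂ , equ , eqℓ , len , eqN) =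
  inj₂ (E ∷ u₁ , u₂ , N ∷ ℓ₁ , ℓ₂ , cong (E ∷_) equ , cong (N ∷_) eqℓ , cong suc len , cong suc eqN)

uncrossed⇒motzkin : ∀ {m k} u ℓ → end u ≡ (m , k) → end ℓ ≡ (m , k) → ¬ Crossing 0 u ℓ →
                    IsMotzkin m k (zipWith label u ℓ)
uncrossed⇒motzkin {m} {k} u ℓ endu endℓ ¬x with walk-or-crossing 0 u ℓ len
  where
  len : length u ≡ length ℓ
  len = trans (end⇒length u endu) (sym (end⇒length ℓ endℓ))
... | inj₂ x = contradiction x ¬x
... | inj₁ (h′ , p) = record
  { walk  = subst (Walk 0 w) h′≡0 p
  ; steps = trans (sym (List.length-map bottomStep w)) (trans (cong length bot) lenℓ)
  ; count = trans (#U,Hᴱ≡#E w) (trans (cong #E bot) (cong proj₁ endℓ))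
  }
  where
  w = zipWith label u ℓ
  lenℓ : length ℓ ≡ m + k
  lenℓ = end⇒length ℓ endℓ
  lenu : length u ≡ m + k
  lenu = end⇒length u endu
  paths = zipWith-paths u ℓ (trans lenu (sym lenℓ))
  bot = proj₂ paths
  h′≡0 : h′ ≡ 0
  h′≡0 = +-cancelʳ-≡ k h′ 0 (begin
    h′ + k                    ≡⟨ cong (λ e → h′ + proj₂ e) (sym endℓ) ⟩
    h′ + #N ℓ                 ≡⟨ cong (λ q → h′ + #N q) (sym bot) ⟩
    h′ + #N (bottomPath w)    ≡⟨ sym (walk-#N p) ⟩
    #N (topPath w)            ≡⟨ cong #N (proj₁ paths) ⟩
    #N u                      ≡⟨ cong proj₂ endu ⟩
    k                         ∎)
    where open ≡-Reasoning

-- A crossing after a E steps and b N steps yields a forbidden subconfiguration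
-- with a + 1 top and b + 1 bottom vertices.
crossing⇒forbidden : ∀ {u ℓ} ys → Crossing 0 u ℓ → Forbidden (heights 0 u) (heights 0 (reflect ℓ) ++ ys)
crossing⇒forbidden ys (u₁ , u₂ , ℓ₁ , ℓ₂ , refl , refl , len , eqN) =
  #E u₁ , #N u₁ , countBelow-heights 0 u₁ u₂ , ≤-trans (subst₂ (λ a b → a < countBelow (suc b) hs) eqa eqb
      (subst (λ p → #E (reflect ℓ₁) < countBelow (suc (#N (reflect ℓ₁))) (heights 0 p))
             (sym (List.map-++ opposite ℓ₁ (N ∷ ℓ₂))) (countBelow-heights 0 (reflect ℓ₁) (reflect ℓ₂))))
    (≤-trans (m≤m+n _ (countBelow (suc (#E u₁)) ys)) (≤-reflexive (sym (countBelow-++ (suc (#E u₁)) hs ys))))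
  where
  hs = heights 0 (reflect (ℓ₁ ++ N ∷ ℓ₂))
  eqa : #E (reflect ℓ₁) ≡ #N u₁
  eqa = trans (#E-reflect ℓ₁) (sym eqN)
  eqb : #N (reflect ℓ₁) ≡ #E u₁
  eqb = trans (#N-reflect ℓ₁) (sym (equal-#E u₁ ℓ₁ len eqN))

-- Motzkin paths and forbidden subconfigurations

+-vacuous : ∀ {i a c} → c ≡ 0 → i ≤ a → a < i + c → ⊥
+-vacuous {i} refl i≤a lt = <⇒≱ (subst (_ <_) (+-identityʳ i) lt) i≤a

+-below : ∀ i {a c} z x → a < i + (below z x + c) → a < suc i + c
+-below i {c = c} z x lt =
  <-≤-trans lt (≤-trans (+-monoʳ-≤ i (+-monoˡ-≤ c (below≤1 z x))) (≤-reflexive (+-suc i c)))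

increasing-bottomHeights : ∀ {m y} ℓ → y + #E ℓ ≡ m → Increasing m y (heights y (reflect ℓ) ++ [ m ])
increasing-bottomHeights {y = y} ℓ eq =
  increasing-∷ʳ⁺ (increasing-heights (reflect ℓ) (trans (cong (y +_) (#N-reflect ℓ)) eq))

-- Here x, y count the N steps of the upper and the E steps of the lower path
-- read so far, i and j the top and bottom entries recorded so far.
walk⇒allowed : ∀ {h w m i j x y} → Walk h w 0 → x ≡ j + h → y ≡ i + h →
               y + #E (bottomPath w) ≡ m → ∀ a b → i ≤ a → j ≤ b →
               a < i + countBelow (suc b) (heights x (topPath w)) →
               b < j + countBelow (suc a) (heights y (reflect (bottomPath w)) ++ [ m ]) → ⊥
walk⇒allowed [] _ _ _ a b i≤a _ lt _ = +-vacuous refl i≤a lt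
walk⇒allowed {h} {i = i} {j} (up p) x≡ y≡ m≡ a b i≤a j≤b =
  walk⇒allowed p (trans (cong suc x≡) (sym (+-suc j h))) (trans (cong suc y≡) (sym (+-suc i h)))
    (trans (sym (+-suc _ _)) m≡) a b i≤a j≤b
-- If this is bottom entry number `b + 1`, all top entries still to come exceed `b`, because the `N`
-- step just read lifts them to at least `j + 1`. Then only `i ≤ a` top entries are small.
walk⇒allowed {w = Hᴺ ∷ w} {j = j} {y = y} (horᴺ p) refl refl m≡ a b i≤a j≤b lt lt′ with j ≟ b
... | yes refl = +-vacuous
      (countBelow-increasing-≤ (increasing-heights (topPath w) refl) (s≤s (m≤m+n j _))) i≤a lt
... | no j≢b = walk⇒allowed p refl refl m≡ a b i≤a (≤∧≢⇒< j≤b j≢b) lt (+-below j (suc a) y lt′)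
walk⇒allowed {w = Hᴱ ∷ w} {i = i} {x = x} {y} (horᴱ p) refl refl m≡ a b i≤a j≤b lt lt′ with i ≟ a
... | yes refl = +-vacuous
      (countBelow-increasing-≤
        (increasing-bottomHeights (bottomPath w) (trans (sym (+-suc y _)) m≡)) (s≤s (m≤m+n i _)))
      j≤b lt′
... | no i≢a = walk⇒allowed p refl refl (trans (sym (+-suc y _)) m≡) a b (≤∧≢⇒< i≤a i≢a) j≤b
      (+-below i (suc b) x lt) lt′
-- Neither counter grows here; that the entries from here on are too large comes from the positive
-- height before the step, as `x = j + suc h` and `y = i + suc h`.
walk⇒allowed {suc h} {D ∷ w} {i = i} {j} {x} {y} (down p) refl refl m≡ a b i≤a j≤b lt lt′
  with i ≟ a | j ≟ b
... | yes refl | _ = +-vacuous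
      (countBelow-increasing-≤ {z = suc i} (increasing-bottomHeights (bottomPath (D ∷ w)) m≡) (m<m+n i z<s))
      j≤b lt′
... | no _ | yes refl = +-vacuous
      (countBelow-increasing-≤ {z = suc j} (increasing-heights (E ∷ topPath w) refl) (m<m+n j z<s))
      i≤a lt
... | no i≢a | no j≢b =
      walk⇒allowed p (+-suc j h) (+-suc i h) m≡ a b (≤∧≢⇒< i≤a i≢a) (≤∧≢⇒< j≤b j≢b)
        (+-below i (suc b) x lt) (+-below j (suc a) y lt′)

-- The configuration and the polyomino of a Motzkin path

take-length-++ : ∀ {A : Set} (xs ys : List A) → take (length xs) (xs ++ ys) ≡ xs
take-length-++ []       ys = refl
take-length-++ (x ∷ xs) ys = cong (x ∷_) (take-length-++ xs ys)

inner-frame : ∀ s p r → inner (s ∷ p ++ [ r ]) ≡ p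
inner-frame s p r = trans (cong (λ k → take (k ∸ 1) (p ++ [ r ])) (trans (List.length-++ p) (+-comm _ 1)))
                          (take-length-++ p [ r ])

Ξ-framed : ∀ w → Ξ (framed w) ≡ w
Ξ-framed w = trans (cong₂ (zipWith label) (inner-frame N (topPath w) E) (inner-frame E (bottomPath w) N))
                   (zipWith-label w)

module Motzkin {m k w} (motz : IsMotzkin m k w) where

  open IsMotzkin motz public

  #E-bottom : #E (bottomPath w) ≡ m
  #E-bottom = trans (sym (#U,Hᴱ≡#E w)) count

  #N-bottom : #N (bottomPath w) ≡ k
  #N-bottom = +-cancelˡ-≡ m _ _ (begin
    m + #N (bottomPath w)                     ≡⟨ cong (_+ #N (bottomPath w)) (sym #E-bottom) ⟩
    #E (bottomPath w) + #N (bottomPath w)     ≡⟨ #E+#N≡length (bottomPath w) ⟩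
    length (bottomPath w)                     ≡⟨ List.length-map bottomStep w ⟩
    length w                                  ≡⟨ steps ⟩
    m + k                                     ∎)
    where open ≡-Reasoning

  #N-top : #N (topPath w) ≡ k
  #N-top = trans (walk-#N walk) #N-bottom

  #E-top : #E (topPath w) ≡ m
  #E-top = +-cancelʳ-≡ k _ _ (begin
    #E (topPath w) + k                  ≡⟨ cong (#E (topPath w) +_) (sym #N-top) ⟩
    #E (topPath w) + #N (topPath w)     ≡⟨ #E+#N≡length (topPath w) ⟩
    length (topPath w)                  ≡⟨ List.length-map topStep w ⟩
    length w                            ≡⟨ steps ⟩
    m + k                               ∎)
    where open ≡-Reasoning

  tops bottoms : List ℕ
  tops    = heights 0 (topPath w)
  bottoms = heights 0 (reflect (bottomPath w)) ++ [ m ]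

  toList-top : toList (proj₁ (config {m} {suc k} (w , motz))) ≡ tops
  toList-top = trans (Vec.toList-cast _ (Vec.fromList (topEntries 0 w)))
                     (trans (Vec.toList∘fromList _) (topEntries≡heights 0 w))

  toList-bottom : toList (proj₂ (config {m} {suc k} (w , motz))) ≡ bottoms
  toList-bottom = trans (Vec.toList-cast _ (Vec.fromList (bottomEntries 0 w ++ [ m ])))
                        (trans (Vec.toList∘fromList _) (cong (_++ [ m ]) (bottomEntries≡heights 0 w)))

  increasing-tops : Increasing k 0 tops
  increasing-tops = increasing-heights (topPath w) #N-top

  increasing-bottoms : Increasing m 0 bottoms
  increasing-bottoms = increasing-bottomHeights (bottomPath w) #E-bottom

  config-sorted : Sorted (config {m} {suc k} (w , motz))
  config-sorted =
    increasing⇒linked _ (subst (Increasing k 0) (sym toList-top) increasing-tops) ,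
    increasing⇒linked _ (subst (Increasing m 0) (sym toList-bottom) increasing-bottoms)

  config-stable : Stable (config {m} {suc k} (w , motz))
  config-stable (top i)    =
    s≤s (increasing⇒lookup≤ _ (subst (Increasing k 0) (sym toList-top) increasing-tops) i)
  config-stable (bottom j) =
    s≤s (increasing⇒lookup≤ _ (subst (Increasing m 0) (sym toList-bottom) increasing-bottoms) j)

  config-allowed : Allowed (config {m} {suc k} (w , motz))
  config-allowed (a , b , lt , lt′) = walk⇒allowed walk refl refl #E-bottom a b z≤n z≤n
    (subst (λ ts → a < countBelow (suc b) ts) toList-top lt)
    (subst (λ bs → b < countBelow (suc a) bs) toList-bottom lt′)

  Φ-config : Φ (config {m} {suc k} (w , motz)) ≡ framed w
  Φ-config = cong₂ _,_
    (trans (cong (λ ts → pathVia N E (suc k) 0 (List.map suc ts ++ [ suc k ])) toList-top)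
           (pathVia-frame 0 (topPath w) z≤n (cong suc (sym #N-top))))
    (begin
      pathVia E N (suc m) 0 (List.map suc (toList (proj₂ (config {m} {suc k} (w , motz)))))
        ≡⟨ cong (λ bs → pathVia E N (suc m) 0 (List.map suc bs)) toList-bottom ⟩
      pathVia E N (suc m) 0 (List.map suc bottoms)
        ≡⟨ cong (pathVia E N (suc m) 0) (List.map-++ suc (heights 0 (reflect (bottomPath w))) [ m ]) ⟩
      pathVia E N (suc m) 0 (List.map suc (heights 0 (reflect (bottomPath w))) ++ [ suc m ])
        -- Reflection makes this an upper path. The last bottom entry `m` supplies the final
        -- `suc m`, as `upperPath` does by appending `n`.
        ≡⟨ sym (reflect-pathVia (suc m) 0 (List.map suc (heights 0 (reflect (bottomPath w))) ++ [ suc m ])) ⟩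
      reflect (pathVia N E (suc m) 0 (List.map suc (heights 0 (reflect (bottomPath w))) ++ [ suc m ]))
        ≡⟨ cong reflect (pathVia-frame 0 (reflect (bottomPath w)) z≤n
             (cong suc (sym (trans (#N-reflect (bottomPath w)) #E-bottom)))) ⟩
      E ∷ reflect (reflect (bottomPath w) ++ [ E ])
        ≡⟨ cong (E ∷_) (List.map-++ opposite (reflect (bottomPath w)) [ E ]) ⟩
      E ∷ reflect (reflect (bottomPath w)) ++ [ N ]
        ≡⟨ cong (λ p → E ∷ p ++ [ N ]) (reflect-involutive (bottomPath w)) ⟩
      E ∷ bottomPath w ++ [ N ] ∎)
    where open ≡-Reasoning

  framed-parallelogram : IsParallelogram m (suc k) (framed w)
  framed-parallelogram = record
    { end-upper = end-upper ; end-lower = end-lower ; above = above ; meet = meet }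
    where
    upper lower : LatticePath
    upper = proj₁ (framed w)
    lower = proj₂ (framed w)
    end-upper : end upper ≡ (suc m , suc k)
    end-upper = cong₂ _,_ (trans (#E-E∷ʳ (topPath w)) (cong suc #E-top))
                          (cong suc (trans (#N-E∷ʳ (topPath w)) #N-top))
    end-lower : end lower ≡ (suc m , suc k)
    end-lower = cong₂ _,_ (cong suc (trans (#E-N∷ʳ (bottomPath w)) #E-bottom))
                          (trans (#N-N∷ʳ (bottomPath w)) (cong suc #N-bottom))
    length-upper : length upper ≡ suc (suc (length w))
    length-upper = cong suc (length-map-∷ʳ topStep w E)
    length-lower : length lower ≡ suc (suc (length w))
    length-lower = cong suc (length-map-∷ʳ bottomStep w N)
    full-upper : ∀ i → suc (length w) < i → take i upper ≡ upper
    full-upper i lt = List.take-all i upper (subst (_≤ i) (sym length-upper) lt)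
    full-lower : ∀ i → suc (length w) < i → take i lower ≡ lower
    full-lower i lt = List.take-all i lower (subst (_≤ i) (sym length-lower) lt)
    above : ∀ i → #N (take i lower) ≤ #N (take i upper)
    above zero = z≤n
    above (suc i) with i ≤? length w
    ... | yes i≤ = m≤n⇒m≤1+n (walk-prefix walk i i≤)
    ... | no i≰  = ≤-reflexive (trans (cong #N (full-lower (suc i) (s≤s (≰⇒> i≰))))
                     (trans (cong proj₂ (trans end-lower (sym end-upper)))
                            (sym (cong #N (full-upper (suc i) (s≤s (≰⇒> i≰)))))))
    meet : ∀ i j → end (take i upper) ≡ end (take j lower) →
           end (take i upper) ≡ (0 , 0) ⊎ end (take i upper) ≡ (suc m , suc k)
    meet zero    j eq = inj₁ refl
    meet (suc i) j eq with i ≤? length w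
    ... | no i≰  = inj₂ (trans (cong end (full-upper (suc i) (s≤s (≰⇒> i≰)))) end-upper)
    -- A common end point forces prefixes of equal length, and there the upper path leads by the
    -- height of the walk plus one.
    ... | yes i≤ = contradiction (trans (cong proj₂ eq) (cong (λ r → #N (take r lower)) j≡))
                     (λ e → <-irrefl (sym e) (s≤s (walk-prefix walk i i≤)))
      where
      length-take : ∀ r p → length p ≡ suc (suc (length w)) →
                    #E (take r p) + #N (take r p) ≡ r ⊓ suc (suc (length w))
      length-take r p len = trans (#E+#N≡length (take r p)) (trans (List.length-take r p) (cong (r ⊓_) len))
      same : suc i ⊓ suc (suc (length w)) ≡ j ⊓ suc (suc (length w))
      same = trans (sym (length-take (suc i) upper length-upper))
               (trans (cong (λ e → proj₁ e + proj₂ e) eq) (length-take j lower length-lower))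
      i⊓ : suc i ⊓ suc (suc (length w)) ≡ suc i
      i⊓ = m≤n⇒m⊓n≡m (s≤s (m≤n⇒m≤1+n i≤))
      j≡ : j ≡ suc i
      j≡ with j ≤? suc (suc (length w))
      ... | yes j≤ = trans (sym (m≤n⇒m⊓n≡m j≤)) (trans (sym same) i⊓)
      ... | no j≰  = contradiction (trans (sym i⊓) (trans same (m≥n⇒m⊓n≡n (<⇒≤ (≰⇒> j≰)))))
                       (<⇒≢ (s≤s (s≤s i≤)))

take-suc-length-++ : ∀ {A : Set} (xs : List A) x ys zs →
                     take (suc (length xs)) ((xs ++ x ∷ ys) ++ zs) ≡ xs ++ [ x ]
take-suc-length-++ []       x ys zs = refl
take-suc-length-++ (z ∷ xs) x ys zs = cong (z ∷_) (take-suc-length-++ xs x ys zs)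

-- The leading `N` above and `E` below are made up for by the crossing steps `E` and `N`. The bound
-- on `a` keeps the meeting point away from the far corner.
crossing-meets : ∀ {u ℓ} → Crossing 0 u ℓ → ∃[ i ] ∃[ a ] ∃[ b ]
                 end (take i (N ∷ u ++ [ E ])) ≡ (suc a , suc b) ×
                 end (take i (E ∷ ℓ ++ [ N ])) ≡ (suc a , suc b) × a < #E u
crossing-meets (u₁ , u₂ , ℓ₁ , ℓ₂ , refl , refl , len , eqN) =
  suc (suc (length u₁)) , #E u₁ , #N u₁ ,
  trans (cong (λ p → end (N ∷ p)) (take-suc-length-++ u₁ E u₂ [ E ]))
        (cong₂ _,_ (#E-E∷ʳ u₁) (cong suc (#N-E∷ʳ u₁))) ,
  trans (cong (λ p → end (E ∷ p))
          (trans (cong (λ i → take (suc i) ((ℓ₁ ++ N ∷ ℓ₂) ++ [ N ])) len) (take-suc-length-++ ℓ₁ N ℓ₂ [ N ])))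
        (cong₂ _,_ (cong suc (trans (#E-N∷ʳ ℓ₁) (sym eqE))) (trans (#N-N∷ʳ ℓ₁) (cong suc (sym eqN)))) ,
  subst (#E u₁ <_) (sym (#E-++ u₁ (E ∷ u₂))) (m<m+n (#E u₁) z<s)
  where
  eqE : #E u₁ ≡ #E ℓ₁
  eqE = equal-#E u₁ ℓ₁ len eqN

-- Decomposing parallelogram polyominoes

module Parallelogram {m k upper lower} (para : IsParallelogram m (suc k) (upper , lower)) where

  open IsParallelogram para using (end-upper; end-lower; above; meet)

  first : ∃[ u ] ∃[ ℓ ] upper ≡ N ∷ u × lower ≡ E ∷ ℓ
  first = go upper lower refl refl
    where
    go : ∀ p q → p ≡ upper → q ≡ lower → ∃[ u ] ∃[ ℓ ] upper ≡ N ∷ u × lower ≡ E ∷ ℓ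
    go []      q       refl refl = contradiction end-upper λ ()
    go (s ∷ p) []      refl refl = contradiction end-lower λ ()
    go (N ∷ p) (E ∷ q) refl refl = p , q , refl , refl
    go (N ∷ p) (N ∷ q) refl refl with meet 1 1 refl
    ... | inj₁ ()
    ... | inj₂ ()
    go (E ∷ p) (E ∷ q) refl refl with meet 1 1 refl
    ... | inj₁ ()
    ... | inj₂ ()
    go (E ∷ p) (N ∷ q) refl refl with above 1
    ... | ()

  frame : ∃[ u ] ∃[ ℓ ] upper ≡ N ∷ u ++ [ E ] × lower ≡ E ∷ ℓ ++ [ N ]
  frame with first
  ... | u′ , ℓ′ , refl , refl with initLast u′ | initLast ℓ′
  ... | []      | _       = contradiction end-upper λ ()
  ... | u ∷ʳ′ s | []      = contradiction end-lower λ ()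
  ... | u ∷ʳ′ s | ℓ ∷ʳ′ r = go s r refl refl
    where
    lengths : length (u ∷ʳ s) ≡ length (ℓ ∷ʳ r)
    lengths = suc-injective (trans (end⇒length upper end-upper) (sym (end⇒length lower end-lower)))
    len : length u ≡ length ℓ
    len = suc-injective (trans (trans (+-comm 1 _) (sym (List.length-++ u)))
                               (trans lengths (trans (List.length-++ ℓ) (+-comm _ 1))))
    take-upper : take (suc (length u)) upper ≡ N ∷ u
    take-upper = cong (N ∷_) (take-length-++ u [ s ])
    take-lower : take (suc (length u)) lower ≡ E ∷ ℓ
    take-lower = cong (E ∷_) (trans (cong (λ i → take i (ℓ ++ [ r ])) len) (take-length-++ ℓ [ r ]))
    -- These prefixes stop one step before the end, away from both permitted meeting points; equal
    -- last steps would make them meet.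
    meeting : end (N ∷ u) ≡ end (E ∷ ℓ) → ⊥
    meeting eq with meet (suc (length u)) (suc (length u))
                      (trans (cong end take-upper) (trans eq (cong end (sym take-lower))))
    ... | inj₁ eq′ = contradiction (cong proj₂ (trans (cong end (sym take-upper)) eq′)) λ ()
    ... | inj₂ eq′ = <-irrefl (end⇒length (N ∷ u) (trans (cong end (sym take-upper)) eq′))
            (subst (suc (length u) <_) (end⇒length upper end-upper)
              (≤-reflexive (cong suc (trans (+-comm 1 _) (sym (List.length-++ u))))))
    eqE = trans (cong proj₁ end-upper) (cong proj₁ (sym end-lower))
    eqN = trans (cong proj₂ end-upper) (cong proj₂ (sym end-lower))
    go : ∀ s′ r′ → s ≡ s′ → r ≡ r′ → ∃[ u ] ∃[ ℓ ] upper ≡ N ∷ u ++ [ E ] × lower ≡ E ∷ ℓ ++ [ N ]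
    go E N refl refl = u , ℓ , refl , refl
    go E E refl refl = ⊥-elim (meeting (cong₂ _,_
      (suc-injective (trans (sym (#E-E∷ʳ u)) (trans eqE (cong suc (#E-E∷ʳ ℓ)))))
      (trans (cong suc (sym (#N-E∷ʳ u))) (trans eqN (#N-E∷ʳ ℓ)))))
    go N N refl refl = ⊥-elim (meeting (cong₂ _,_
      (trans (sym (#E-N∷ʳ u)) (trans eqE (cong suc (#E-N∷ʳ ℓ))))
      (suc-injective (trans (cong suc (sym (#N-N∷ʳ u))) (trans eqN (#N-N∷ʳ ℓ))))))
    go N E refl refl = contradiction (above (suc (length u)))
      (<⇒≱ (subst₂ _<_ (sym (cong #N take-upper)) (sym (cong #N take-lower))
        (≤-reflexive (trans (cong suc (sym (#N-N∷ʳ u))) (trans eqN (#N-E∷ʳ ℓ))))))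

  decompose : ∃[ w ] IsMotzkin m k w × (upper , lower) ≡ framed w
  decompose with frame
  ... | u , ℓ , refl , refl = zipWith label u ℓ , motz ,
        sym (cong₂ _,_ (cong (λ p → N ∷ p ++ [ E ]) (proj₁ paths)) (cong (λ p → E ∷ p ++ [ N ]) (proj₂ paths)))
    where
    end-u : end u ≡ (m , k)
    end-u = cong₂ _,_ (suc-injective (trans (sym (#E-E∷ʳ u)) (cong proj₁ end-upper)))
                      (suc-injective (trans (cong suc (sym (#N-E∷ʳ u))) (cong proj₂ end-upper)))
    end-ℓ : end ℓ ≡ (m , k)
    end-ℓ = cong₂ _,_ (suc-injective (trans (cong suc (sym (#E-N∷ʳ ℓ))) (cong proj₁ end-lower)))
                      (suc-injective (trans (sym (#N-N∷ʳ ℓ)) (cong proj₂ end-lower)))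
    len : length u ≡ length ℓ
    len = trans (end⇒length u end-u) (sym (end⇒length ℓ end-ℓ))
    paths = zipWith-paths u ℓ len
    uncrossed : ¬ Crossing 0 u ℓ
    uncrossed x with crossing-meets x
    ... | i , a , b , eq-upper , eq-lower , a< with meet i i (trans eq-upper (sym eq-lower))
    ...   | inj₁ eq = contradiction (trans (sym eq-upper) eq) λ ()
    ...   | inj₂ eq = <-irrefl (suc-injective (cong proj₁ (trans (sym eq-upper) eq)))
                               (subst (a <_) (cong proj₁ end-u) a<)
    motz : IsMotzkin m k (zipWith label u ℓ)
    motz = uncrossed⇒motzkin u ℓ end-u end-ℓ uncrossed

-- Recovering a word from a configuration

module Configuration {m k} {t : Vec ℕ m} {b : Vec ℕ (suc k)}
       (sorted : Sorted (t , b)) (stable : Stable (t , b)) (ok : Allowed (t , b)) where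

  increasing-t : Increasing k 0 (toList t)
  increasing-t = linked⇒increasing (proj₁ sorted) (λ i → ≤-pred (stable (top i)))

  increasing-b : Increasing m 0 (toList b)
  increasing-b = linked⇒increasing (proj₂ sorted) (λ j → ≤-pred (stable (bottom j)))

  countBelow-t : countBelow (suc k) (toList t) ≡ m
  countBelow-t = trans (countBelow-increasing-> increasing-t ≤-refl) (Vec.length-toList t)

  -- Otherwise all non-sink vertices together are forbidden: stability keeps the `m` tops below
  -- `n = suc k`, and the `n` bottoms would all be below `m`. This explains the entry `m` at the end
  -- of `config`.
  ends-in-m : ∀ bs y → toList b ≡ bs ++ [ y ] → Increasing y 0 bs → y ≤ m → y ≡ m
  ends-in-m bs y eq inc y≤m with y ≟ m
  ... | yes y≡m = y≡m
  ... | no y≢m  = ⊥-elim (too-small m (≤∧≢⇒< y≤m y≢m) countBelow-t)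
    where
    too-small : ∀ m′ → y < m′ → countBelow (suc k) (toList t) ≡ m′ → ⊥
    too-small (suc m′) y<m eq-t = ok (m′ , k , ≤-reflexive (sym eq-t) , ≤-reflexive (sym (begin
      countBelow (suc m′) (toList b)      ≡⟨ cong (countBelow (suc m′)) eq ⟩
      countBelow (suc m′) (bs ++ [ y ])   ≡⟨ countBelow-increasing-> (increasing-∷ʳ⁺ inc) y<m ⟩
      length (bs ++ [ y ])         ≡⟨ cong length (sym eq) ⟩
      length (toList b)            ≡⟨ Vec.length-toList b ⟩
      suc k                        ∎)))
      where open ≡-Reasoning

  last-bottom : ∃[ bs ] toList b ≡ bs ++ [ m ] × Increasing m 0 bs
  last-bottom = go (toList b) refl
    where
    go : ∀ xs → toList b ≡ xs → ∃[ bs ] toList b ≡ bs ++ [ m ] × Increasing m 0 bs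
    go xs eq with initLast xs
    ... | []       = contradiction (trans (sym (Vec.length-toList b)) (cong length eq)) λ ()
    ... | bs ∷ʳ′ y with increasing-∷ʳ⁻ bs (subst (Increasing m 0) eq increasing-b)
    ...   | inc , y≤m with ends-in-m bs y eq inc y≤m
    ...     | refl = bs , eq , inc

  word : ∃[ w ] Σ[ motz ∈ IsMotzkin m k w ] config {m} {suc k} (w , motz) ≡ (t , b)
  word with last-bottom
  ... | bs , eq , inc = w , motz , cong₂ _,_
        (vec-ext (trans M.toList-top (trans (cong (heights 0) (proj₁ paths)) heights-u)))
        (vec-ext (trans M.toList-bottom
          (trans (cong (_++ [ m ]) (trans (cong (heights 0 ∘ reflect) (proj₂ paths)) heights-ℓ)) (sym eq))))
    where
    vec-ext : ∀ {r} {xs ys : Vec ℕ r} → toList xs ≡ toList ys → xs ≡ ys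
    vec-ext {xs = xs} {ys} e = trans (sym (Vec.cast-is-id refl xs)) (Vec.toList-injective refl xs ys e)
    u p ℓ : LatticePath
    -- Unlike in `Φ`, entries are not shifted and the bound is `k`, not `n`: these are the paths
    -- without their frame.
    u = pathVia N E k 0 (toList t)
    p = pathVia N E m 0 bs
    ℓ = reflect p
    w = zipWith label u ℓ
    heights-u : heights 0 u ≡ toList t
    heights-u = heights-pathVia increasing-t
    heights-ℓ : heights 0 (reflect ℓ) ≡ bs
    heights-ℓ = trans (cong (heights 0) (reflect-involutive p)) (heights-pathVia inc)
    end-u : end u ≡ (m , k)
    end-u = cong₂ _,_ (trans (sym (length-heights 0 u)) (trans (cong length heights-u) (Vec.length-toList t)))
                      (trans (sym (+-identityʳ _)) (#N-pathVia increasing-t))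
    end-ℓ : end ℓ ≡ (m , k)
    end-ℓ = cong₂ _,_ (trans (#E-reflect p) (trans (sym (+-identityʳ _)) (#N-pathVia inc)))
      (trans (#N-reflect p) (trans (sym (length-heights 0 p)) (trans (cong length (heights-pathVia inc))
        (suc-injective (trans (+-comm 1 _) (trans (sym (List.length-++ bs))
          (trans (cong length (sym eq)) (Vec.length-toList b))))))))
    len : length u ≡ length ℓ
    len = trans (end⇒length u end-u) (sym (end⇒length ℓ end-ℓ))
    paths = zipWith-paths u ℓ len
    uncrossed : ¬ Crossing 0 u ℓ
    uncrossed x = ok (subst₂ Forbidden heights-u (trans (cong (_++ [ m ]) heights-ℓ) (sym eq))
                        (crossing⇒forbidden [ m ] x))
    motz : IsMotzkin m k w
    motz = uncrossed⇒motzkin u ℓ end-u end-ℓ uncrossed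
    module M = Motzkin motz

-- The three bijections

module Bijections (m k : ℕ) where

  config-recurrent : ∀ {w} (motz : IsMotzkin m k w) →
                     DeterministicallyRecurrent (config {m} {suc k} (w , motz))
  config-recurrent motz = config-stable ,
    returns⇒recurrent (config (_ , motz)) config-stable
      (Burning.burning config-sorted config-allowed) (bottom Fin.zero)
    where open Motzkin motz

  config-parallelogram : ∀ {w} (motz : IsMotzkin m k w) →
                         IsParallelogram m (suc k) (Φ (config {m} {suc k} (w , motz)))
  config-parallelogram motz = subst (IsParallelogram m (suc k)) (sym Φ-config) framed-parallelogram
    where open Motzkin motz

  Ξ-Φ-config : ∀ {w} (motz : IsMotzkin m k w) → Ξ (Φ (config {m} {suc k} (w , motz))) ≡ w
  Ξ-Φ-config {w} motz = trans (cong Ξ (Motzkin.Φ-config motz)) (Ξ-framed w)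

  toConfig : Carrier (Motz m k) → Carrier (SortedRec m (suc k))
  toConfig (w , motz) = config (w , motz) , Motzkin.config-sorted motz , config-recurrent motz

  fromSortedRec : ((c , _) : Carrier (SortedRec m (suc k))) →
                  Σ[ w ∈ Carrier (Motz m k) ] config {m} {suc k} w ≡ c
  fromSortedRec (c , sorted , stable , rec) = (proj₁ w , proj₁ (proj₂ w)) , proj₂ (proj₂ w)
    where w = Configuration.word sorted stable (recurrent⇒allowed c stable rec)

  toPolyomino : Carrier (SortedRec m (suc k)) → Carrier (Polyomino m (suc k))
  toPolyomino c = Φ (proj₁ c) , para (fromSortedRec c)
    where
    para : Σ[ w ∈ Carrier (Motz m k) ] config {m} {suc k} w ≡ proj₁ c → IsParallelogram m (suc k) (Φ (proj₁ c))
    para ((w , motz) , eq) = subst (λ d → IsParallelogram m (suc k) (Φ d)) eq (config-parallelogram motz)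

  toWord : Carrier (Polyomino m (suc k)) → Carrier (Motz m k)
  toWord (P , para) = Ξ P , motz (Parallelogram.decompose para)
    where
    motz : Σ[ w ∈ List MStep ] IsMotzkin m k w × P ≡ framed w → IsMotzkin m k (Ξ P)
    motz (w , motz , refl) = subst (IsMotzkin m k) (sym (Ξ-framed w)) motz

  -- `Vec.cast` takes its equation irrelevantly, so the proof that a word is a Motzkin path does not
  -- affect its configuration.
  config-cong : ∀ (v w : Carrier (Motz m k)) → proj₁ v ≡ proj₁ w → config {m} {suc k} v ≡ config {m} {suc k} w
  config-cong (w , _) (.w , _) refl = refl

  word-polyomino-config : ∀ w → proj₁ (toWord (toPolyomino (toConfig w))) ≡ proj₁ w
  word-polyomino-config (w , motz) = Ξ-Φ-config motz

  config-word-polyomino : ∀ c → proj₁ (toConfig (toWord (toPolyomino c))) ≡ proj₁ c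
  config-word-polyomino c =
    trans (config-cong (toWord (toPolyomino c)) w
                       (trans (cong (λ d → Ξ (Φ d)) (sym (proj₂ (fromSortedRec c)))) (Ξ-Φ-config (proj₂ w))))
          (proj₂ (fromSortedRec c))
    where w = proj₁ (fromSortedRec c)

  polyomino-config-word : ∀ P → proj₁ (toPolyomino (toConfig (toWord P))) ≡ proj₁ P
  polyomino-config-word (P , para) =
    trans (Motzkin.Φ-config (proj₂ (toWord (P , para)))) (framed-Ξ (Parallelogram.decompose para))
    where
    framed-Ξ : Σ[ w ∈ List MStep ] IsMotzkin m k w × P ≡ framed w → framed (Ξ P) ≡ P
    framed-Ξ (w , _ , eq) = trans (cong framed (trans (cong Ξ eq) (Ξ-framed w))) (sym eq)

  Φ↔ : Inverse (SortedRec m (suc k)) (Polyomino m (suc k))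
  Φ↔ = record
    { to        = toPolyomino
    ; from      = λ P → toConfig (toWord P)
    ; to-cong   = cong Φ
    ; from-cong = λ {P} {Q} eq → config-cong (toWord P) (toWord Q) (cong Ξ eq)
    ; inverse   = (λ {P} eq → trans (cong Φ eq) (polyomino-config-word P))
                , (λ {c} {P} eq → trans (config-cong (toWord P) (toWord (toPolyomino c)) (cong Ξ eq))
                                      (config-word-polyomino c))
    }

  Ξ↔ : Inverse (Polyomino m (suc k)) (Motz m k)
  Ξ↔ = record
    { to        = toWord
    ; from      = λ w → toPolyomino (toConfig w)
    ; to-cong   = cong Ξ
    ; from-cong = λ {v} {w} eq → cong Φ (config-cong v w eq)
    ; inverse   = (λ {w} eq → trans (cong Ξ eq) (word-polyomino-config w))
                , (λ {P} {w} eq → trans (cong Φ (config-cong w (toWord P) eq)) (polyomino-config-word P))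
    }

  c↔ : Inverse (Motz m k) (SortedRec m (suc k))
  c↔ = record
    { to        = toConfig
    ; from      = λ c → toWord (toPolyomino c)
    ; to-cong   = λ {v} {w} eq → config-cong v w eq
    ; from-cong = cong (λ c → Ξ (Φ c))
    ; inverse   = (λ {c} {w} eq → trans (config-cong w (toWord (toPolyomino c)) eq) (config-word-polyomino c))
                , (λ {w} eq → trans (cong (λ c → Ξ (Φ c)) eq) (word-polyomino-config w))
    }

theorem4p14 : ∀ (m n : ℕ) .{{_ : NonZero n}} →
    ( ∀ (w : Carrier (Motz m (pred n))) →
    Sorted (config {m} {n} w)
    × DeterministicallyRecurrent (config {m} {n} w)
    × IsParallelogram m n (Φ (config {m} {n} w))
    × Ξ (Φ (config {m} {n} w)) ≡ proj₁ w )
    ×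
    ( Σ[ Φ↔ ∈ Inverse (SortedRec m n) (Polyomino m n) ]
    Σ[ Ξ↔ ∈ Inverse (Polyomino m n) (Motz m (pred n)) ]
    Σ[ c↔ ∈ Inverse (Motz m (pred n)) (SortedRec m n) ]
    (∀ c → proj₁ (to Φ↔ c) ≡ Φ (proj₁ c))
    × (∀ P → proj₁ (to Ξ↔ P) ≡ Ξ (proj₁ P))
    × (∀ w → proj₁ (to c↔ w) ≡ config {m} {n} w)
    × (∀ w → proj₁ (to c↔ w) ≡ proj₁ (from Φ↔ (from Ξ↔ w))) )
theorem4p14 m zero    = ⊥-elim (≢-nonZero⁻¹ 0 refl)
theorem4p14 m (suc k) =
  (λ { (w , motz) → Motzkin.config-sorted motz , config-recurrent motz ,
                    config-parallelogram motz , Ξ-Φ-config motz }) ,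
  Φ↔ , Ξ↔ , c↔ , (λ _ → refl) , (λ _ → refl) , (λ _ → refl) ,
  λ w → config-cong w (toWord (toPolyomino (toConfig w))) (sym (word-polyomino-config w))
  where open Bijections m k
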